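{- Let $p\geq 5$ be prime, let $A$ be a $k\times n$ matrix over $\mathbb{F}_p$ of rank $k$ with $d_A=d$, and let $b\in\mathbb{F}_p^k$ be such that $A\cdot x=b$ has no solution in $\{0,1\}^n$. Then in the LinTrees$^{(p)}$ Prover–Delayer game on $A\cdot x=b$ there exists a Delayer strategy that guarantees selection of $\Omega(d^{0.2})$ branching points (i.e. at least $c\,d^{0.2}$ branching points for a constant $c>0$ depending only on $p$).
   Context: For $v\in\mathbb{F}_p^n$, $\omega(v)$ is the number of nonzero coordinates; $d_A:=\min_{y\neq 0}\omega(y\cdot A)$. For a linear form $f$ in $x_1,\dots,x_n$, $f(\{0,1\}^n)\subseteq\mathbb{F}_p$ is its set of values on Boolean assignments. LinTrees$^{(p)}$ Prover–Delayer game on a 0-1 unsatisfiable linear system $\mathcal{F}$: a position is a set $\mathcal{H}$ of linear equations; the game starts with $\mathcal{H}=\mathcal{F}$. In each round Prover chooses a linear form $f$; Delayer either chooses some $a\in f(\{0,1\}^n)$ and the equation $f=a$ is added to $\mathcal{H}$, or declares the position a branching point and chooses $a_1\neq a_2\in f(\{0,1\}^n)$, after which Prover chooses which of $f=a_1$, $f=a_2$ is added to $\mathcal{H}$. The game ends when $\mathcal{H}$ has no solution in $\mathbb{F}_p^n$. A Delayer strategy guarantees selection of $h$ branching points if in every play consistent with it (against any Prover), at least $h$ branching points are declared before the game ends. -}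

module Defs where

open import Data.Nat using (ℕ; zero; suc; _+_; _*_; NonZero)
open import Data.Nat.DivMod using (_mod_)
open import Data.Fin using (Fin; toℕ) renaming (zero to fz; suc to fs)
open import Data.Fin.Properties using () renaming (_≟_ to _≟F_)
open import Data.Bool using (Bool; true; false; if_then_else_)
open import Data.List using (List; []; _∷_)
open import Data.Product using (Σ; _×_; _,_; proj₁; proj₂)
open import Relation.Binary.PropositionalEquality using (_≡_)
open import Relation.Nullary using (¬_; yes; no)

module Field (p : ℕ) .{{_ : NonZero p}} where

  𝔽 : Set
  𝔽 = Fin p

  0F : 𝔽
  0F = 0 mod p

  1F : 𝔽
  1F = 1 mod p

  _+F_ : 𝔽 → 𝔽 → 𝔽
  a +F b = (toℕ a + toℕ b) mod p

  _*F_ : 𝔽 → 𝔽 → 𝔽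
  a *F b = (toℕ a * toℕ b) mod p

  ΣF : ∀ {n} → (Fin n → 𝔽) → 𝔽
  ΣF {zero}  v = 0F
  ΣF {suc n} v = v fz +F ΣF (λ i → v (fs i))

  Vecₚ : ℕ → Set
  Vecₚ n = Fin n → 𝔽

  ω : ∀ {n} → Vecₚ n → ℕ
  ω {zero}  v = 0
  ω {suc n} v = (if isZero (v fz) then 0 else 1) + ω (λ i → v (fs i))
    where
    isZero : 𝔽 → Bool
    isZero a with a ≟F 0F
    ... | yes _ = true
    ... | no  _ = false

  Matrix : ℕ → ℕ → Set
  Matrix k n = Fin k → Fin n → 𝔽

  _·ᵣ_ : ∀ {k n} → Vecₚ k → Matrix k n → Vecₚ n
  (y ·ᵣ A) j = ΣF (λ i → y i *F A i j)

  _·ᶜ_ : ∀ {k n} → Matrix k n → Vecₚ n → Vecₚ k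
  (A ·ᶜ x) i = ΣF (λ j → A i j *F x j)

  IsZeroVec : ∀ {n} → Vecₚ n → Set
  IsZeroVec v = ∀ j → v j ≡ 0F

  HasFullRowRank : ∀ {k n} → Matrix k n → Set
  HasFullRowRank A = ∀ y → IsZeroVec (y ·ᵣ A) → IsZeroVec y

  HasDistance : ∀ {k n} → Matrix k n → ℕ → Set
  HasDistance {k} A d =
    (∀ (y : Vecₚ k) → ¬ IsZeroVec y → d Data.Nat.≤ ω (y ·ᵣ A))
    × Σ (Vecₚ k) (λ y → ¬ IsZeroVec y × ω (y ·ᵣ A) ≡ d)

  bool→𝔽 : Bool → 𝔽
  bool→𝔽 true  = 1F
  bool→𝔽 false = 0F

  embed : ∀ {n} → (Fin n → Bool) → Vecₚ n
  embed x j = bool→𝔽 (x j)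

  No01Solution : ∀ {k n} → Matrix k n → Vecₚ k → Set
  No01Solution {n = n} A b = ¬ Σ (Fin n → Bool) (λ x → ∀ i → (A ·ᶜ embed x) i ≡ b i)

  Form : ℕ → Set
  Form n = Vecₚ n

  evalF : ∀ {n} → Form n → Vecₚ n → 𝔽
  evalF f x = ΣF (λ j → f j *F x j)

  _∈Img_ : ∀ {n} → 𝔽 → Form n → Set
  _∈Img_ {n} a f = Σ (Fin n → Bool) (λ x → evalF f (embed x) ≡ a)

  Equation : ℕ → Set
  Equation n = Form n × 𝔽

  SatisfiesEq : ∀ {n} → Vecₚ n → Equation n → Set
  SatisfiesEq x (f , a) = evalF f x ≡ a

  systemEqs : ∀ {k n} → Matrix k n → Vecₚ k → Fin k → Equation n
  systemEqs A b i = (A i , b i)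

  data _∈L_ {n} (e : Equation n) : List (Equation n) → Set where
    here  : ∀ {es} → e ∈L (e ∷ es)
    there : ∀ {e' es} → e ∈L es → e ∈L (e' ∷ es)

  Unsolvable : ∀ {k n} → Matrix k n → Vecₚ k → List (Equation n) → Set
  Unsolvable {n = n} A b H =
    ¬ Σ (Vecₚ n) (λ x → (∀ i → SatisfiesEq x (systemEqs A b i))
                         × (∀ e → e ∈L H → SatisfiesEq x e))

  data Move {n} (f : Form n) : Set where
    single : (a : 𝔽) → a ∈Img f → Move f
    branch : (a₁ a₂ : 𝔽) → ¬ a₁ ≡ a₂ → a₁ ∈Img f → a₂ ∈Img f → Move f

  -- A Delayer strategy: given the equations added so far (the history,
  -- most recent first) and Prover's form f, Delayer's move.
  Strategy : ℕ → Set
  Strategy n = List (Equation n) → (f : Form n) → Move f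

  -- A Prover script: in each round a linear form, together with which of the
  -- two equations Prover picks in case Delayer branches (true = a₁).
  Script : ℕ → Set
  Script n = List (Form n × Bool)

  run : ∀ {n} → Strategy n → List (Equation n) → Script n → List (Equation n) × ℕ
  run σ H [] = (H , 0)
  run σ H ((f , c) ∷ s) with σ H f
  ... | single a _ = run σ ((f , a) ∷ H) s
  ... | branch a₁ a₂ _ _ _ =
        let r = run σ ((f , (if c then a₁ else a₂)) ∷ H) s
        in (proj₁ r , suc (proj₂ r))

  -- σ guarantees at least (d / N)^{1/5} branching points, i.e. d ≤ N · h^5
  -- where h is the number of branching points of any finished play.
  GuaranteesRoot5 : ∀ {k n} → Matrix k n → Vecₚ k → Strategy n → ℕ → ℕ → Set
  GuaranteesRoot5 A b σ N d =
    ∀ (s : Script _) → Unsolvable A b (proj₁ (run σ [] s))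
                     → d Data.Nat.≤ N * (proj₂ (run σ [] s) Data.Nat.^ 5)

-- Delayer keeps a Boolean assignment ρ of few fixed coordinates and a system of equations, extending
-- the rows of A by at most one equation per branching point, whose nontrivial combinations all have
-- weight at least T on the free coordinates. A form lying within weight D = T/2 of the row space is
-- answered by fixing the free coordinates on which it differs from it (a forced answer if there are
-- none); any other form is adjoined as a new equation. Either way the weights stay above D, and each
-- combination u lighter than T is then traded for the coordinates of its support: some equation not
-- in A is replaced by u, and u is dropped once these coordinates are assigned so as to satisfy it. An
-- equation pays for T coordinates, so fewer than d are ever fixed and no combination of A gets light.
-- The dropped equations are at most M in number and of weight at least D, and these have a Boolean
-- solution for every right-hand side when D is a large multiple of M²: if X contains no line in
-- direction v then |X ∪ (X + v)| ≥ p/(p-1) |X|, so the subset sums of O(M) nonzero vectors in F_p^M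
-- contain a line, and one passes to the quotient by it. Hence d of order M³ suffices for M branchings,
-- and M ~ d^(1/5) is more than the argument needs.
module Submission where

open import Defs
open import Data.Nat using (ℕ; NonZero; _≤_)
open import Data.Nat.Primality using (Prime)
open import Data.Product using (Σ; _×_)
open import Algebra using (CommutativeRing)
import Algebra.Properties.Group as GroupProps
open import Algebra.Structures using (IsCommutativeRing)
open import Data.Bool using (Bool; true; false; if_then_else_; not; _∧_; _∨_)
import Data.Bool.Properties as Bool
open import Data.Empty using (⊥)
open import Data.Fin using (Fin; toℕ; _≟_) renaming (zero to fz; suc to fs)
open import Data.Fin.Properties using (any?; all?; toℕ-injective; toℕ-fromℕ<; toℕ<n; toℕ≤pred[n]; suc-injective)
open import Data.List using (List; []; _∷_; _++_; map; filter; length; cartesianProductWith; upTo; allFin)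
import Data.List.Membership.DecPropositional as DecMembership
open import Data.List.Membership.Propositional using (_∈_; _∉_)
open import Data.List.Membership.Propositional.Properties
open import Data.List.Properties using (length-++; length-map; length-upTo; length-tabulate)
open import Data.List.Relation.Unary.All as All using ([]; _∷_)
open import Data.List.Relation.Unary.AllPairs using ([]; _∷_)
open import Data.List.Relation.Unary.Any using (here; there)
open import Data.List.Relation.Unary.Unique.Propositional using (Unique)
import Data.List.Relation.Unary.Unique.Propositional.Properties as Unique
open import Data.Maybe using (Maybe; just; nothing)
open import Data.Nat using (zero; suc; _+_; _*_; _∸_; _^_; _%_; _<_; _<?_; _≤?_; z≤n; s≤s; >-nonZero; ≢-nonZero; nonTrivial⇒n>1)
open import Data.Nat.Coprimality using (prime⇒coprime; coprime-Bézout)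
open import Data.Nat.DivMod using (_mod_; m<n⇒m%n≡m; %-distribˡ-+; %-distribˡ-*; n%n≡0; m*n%n≡0; [m+kn]%n≡m%n)
open import Data.Nat.GCD using (module Bézout)
open import Data.Nat.Primality using (prime⇒nonTrivial)
open import Data.Nat.Properties hiding (_≟_; _<?_; _≤?_; suc-injective)
open import Data.Nat.Tactic.RingSolver using () renaming (solve-∀ to solve-ℕ)
open import Data.Product using (∃; _,_; proj₁; proj₂)
open import Data.Sum using (_⊎_; inj₁; inj₂)
open import Data.Unit using (⊤; tt)
open import Data.Vec using (Vec; []; _∷_; lookup; tabulate; replicate; zipWith)
open import Data.Vec.Properties using (tabulate∘lookup; lookup∘tabulate; tabulate-cong; lookup-zipWith; lookup-replicate; ≡-dec)
open import Function using (_∘_)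
open import Relation.Binary.Definitions using (DecidableEquality)
open import Relation.Binary.PropositionalEquality hiding (J)
open import Relation.Nullary using (¬_; Dec; yes; no; does; ¬?; contradiction; _×-dec_; _→-dec_)
open import Relation.Nullary.Decidable using (map′)
open import Relation.Unary using (Decidable)
open import Tactic.RingSolver using (solve-∀)
open import Tactic.RingSolver.Core.AlmostCommutativeRing using (AlmostCommutativeRing; fromCommutativeSemiring)

-- Counting, exhaustive search and duplicate-free lists.

count : ∀ {n} → (Fin n → Bool) → ℕ
count {zero}  P = 0
count {suc n} P = (if P fz then 1 else 0) + count (P ∘ fs)

count-cover : ∀ {n} {P Q R : Fin n → Bool} →
  (∀ j → P j ≡ true → Q j ≡ true ⊎ R j ≡ true) → count P ≤ count Q + count R
count-cover {zero}  h = z≤n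
count-cover {suc n} {P} {Q} {R} h with count-cover {n} {P ∘ fs} {Q ∘ fs} {R ∘ fs} (h ∘ fs)
... | ih with P fz | Q fz | R fz | h fz
... | false | false | false | _ = ih
... | false | false | true  | _ rewrite +-suc (count (Q ∘ fs)) (count (R ∘ fs)) = m≤n⇒m≤1+n ih
... | false | true  | false | _ = m≤n⇒m≤1+n ih
... | false | true  | true  | _ rewrite +-suc (count (Q ∘ fs)) (count (R ∘ fs)) = m≤n⇒m≤1+n (m≤n⇒m≤1+n ih)
... | true  | true  | false | _ = s≤s ih
... | true  | true  | true  | _ rewrite +-suc (count (Q ∘ fs)) (count (R ∘ fs)) = s≤s (m≤n⇒m≤1+n ih)
... | true  | false | true  | _ rewrite +-suc (count (Q ∘ fs)) (count (R ∘ fs)) = s≤s ih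
... | true  | false | false | c with c refl
...   | inj₁ ()
...   | inj₂ ()

count-none : ∀ {n} → count {n} (λ _ → false) ≡ 0
count-none {zero}  = refl
count-none {suc n} = count-none {n}

count-mono : ∀ {n} {P Q : Fin n → Bool} → (∀ j → P j ≡ true → Q j ≡ true) → count P ≤ count Q
count-mono {n} {P} {Q} h = ≤-trans (count-cover {R = λ _ → false} (λ j e → inj₁ (h j e)))
  (≤-reflexive (trans (cong (count Q +_) (count-none {n})) (+-identityʳ _)))

count-pos : ∀ {n} {P : Fin n → Bool} j → P j ≡ true → 1 ≤ count P
count-pos fz     e rewrite e = s≤s z≤n
count-pos (fs j) e = ≤-trans (count-pos j e) (m≤n+m _ _)

count-∃ : ∀ {n} {P : Fin n → Bool} → 1 ≤ count P → ∃ λ j → P j ≡ true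
count-∃ {suc n} {P} h with P fz in e
... | true  = fz , e
... | false = let j , q = count-∃ {P = P ∘ fs} h in fs j , q

infixl 6 _∖_

_∖_ : ∀ {n} → (Fin n → Bool) → Fin n → Fin n → Bool
(P ∖ i) j = P j ∧ not (does (i ≟ j))

∖-self : ∀ {n} (P : Fin n → Bool) i → (P ∖ i) i ≡ false
∖-self P i with i ≟ i
... | no ¬e = contradiction refl ¬e
... | yes _ with P i
...   | true  = refl
...   | false = refl

∖-other : ∀ {n} (P : Fin n → Bool) {i j} → i ≢ j → (P ∖ i) j ≡ P j
∖-other P {i} {j} i≢j with i ≟ j
... | yes e = contradiction e i≢j
... | no _ with P j
...   | true  = refl
...   | false = refl

∖-true : ∀ {n} (P : Fin n → Bool) {i j} → (P ∖ i) j ≡ true → P j ≡ true × i ≢ j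
∖-true P {i} {j} e with i ≟ j | P j
... | no i≢j | true = refl , i≢j
... | yes _  | true  with () ← e
... | yes _  | false with () ← e
... | no _   | false with () ← e

∖-suc : ∀ {n} (P : Fin (suc n) → Bool) i j → (P ∖ fs i) (fs j) ≡ true → ((P ∘ fs) ∖ i) j ≡ true
∖-suc P i j q with ∖-true P {fs i} {fs j} q
... | e , i≢j = trans (∖-other (P ∘ fs) (i≢j ∘ cong fs)) e

count-∖ : ∀ {n} (P : Fin n → Bool) {i} → P i ≡ true → suc (count (P ∖ i)) ≤ count P
count-∖ P {fz} e rewrite e = s≤s (count-mono λ j q → proj₁ (∖-true P {fz} {fs j} q))
count-∖ P {fs i} e with P fz
... | true  = s≤s (≤-trans (s≤s (count-mono (∖-suc P i))) (count-∖ (P ∘ fs) e))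
... | false = ≤-trans (s≤s (count-mono (∖-suc P i))) (count-∖ (P ∘ fs) e)

infixr 5 _◂_

_◂_ : ∀ {A : Set} {n} → A → (Fin n → A) → Fin (suc n) → A
(a ◂ v) fz     = a
(a ◂ v) (fs i) = v i

-- The recursion meets a witness `v` only in the form `v fz ◂ v ∘ fs`, which is pointwise equal to
-- it, so `P` has to respect pointwise equality.
search : ∀ {p r} {P : (Fin r → Fin p) → Set} →
  (∀ {u v} → (∀ i → u i ≡ v i) → P u → P v) → (∀ v → Dec (P v)) → Dec (∃ P)
search {r = zero}  resp P? = map′ (λ x → _ , x) (λ (_ , x) → resp (λ ()) x) (P? (λ ()))
search {r = suc r} {P} resp P? = map′
  (λ (a , v , x) → a ◂ v , x)
  (λ (v , x) → v fz , v ∘ fs , resp (λ { fz → refl ; (fs i) → refl }) x)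
  (any? λ a → search {P = λ v → P (a ◂ v)}
    (λ e → resp λ { fz → refl ; (fs i) → e i }) (λ v → P? (a ◂ v)))

-- Pigeonhole: each entry of `xs` strikes out one occurrence in `ys`, and by uniqueness no later
-- entry needs the struck one.
unique-⊆⇒length≤ : ∀ {A : Set} {xs ys : List A} → Unique xs → (∀ {x} → x ∈ xs → x ∈ ys) →
  length xs ≤ length ys
unique-⊆⇒length≤ [] sub = z≤n
unique-⊆⇒length≤ {xs = x ∷ xs} (x∉ ∷ u) sub with ∈-∃++ (sub (here refl))
... | ys₁ , ys₂ , refl = begin
  suc (length xs)               ≤⟨ s≤s (unique-⊆⇒length≤ u sub′) ⟩
  suc (length (ys₁ ++ ys₂))     ≡⟨ cong suc (length-++ ys₁) ⟩
  suc (length ys₁ + length ys₂) ≡⟨ +-suc (length ys₁) (length ys₂) ⟨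
  length ys₁ + suc (length ys₂) ≡⟨ length-++ ys₁ ⟨
  length (ys₁ ++ x ∷ ys₂)       ∎
  where
  open ≤-Reasoning
  sub′ : ∀ {z} → z ∈ xs → z ∈ ys₁ ++ ys₂
  sub′ z∈ with ∈-++⁻ ys₁ (sub (there z∈))
  ... | inj₁ q           = ∈-++⁺ˡ q
  ... | inj₂ (here refl) = contradiction refl (All.lookup x∉ z∈)
  ... | inj₂ (there q)   = ∈-++⁺ʳ ys₁ q

length-cartesianProductWith : ∀ {A B C : Set} (f : A → B → C) xs ys →
  length (cartesianProductWith f xs ys) ≡ length xs * length ys
length-cartesianProductWith f []       ys = refl
length-cartesianProductWith f (x ∷ xs) ys = trans (length-++ (map (f x) ys))
  (cong₂ _+_ (length-map (f x) ys) (length-cartesianProductWith f xs ys))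

-- Growth of a finite set under a periodic map.

iter : ∀ {A : Set} → ℕ → (A → A) → A → A
iter zero    f x = x
iter (suc i) f x = f (iter i f x)

iter-+ : ∀ {A : Set} i j (f : A → A) x → iter (i + j) f x ≡ iter i f (iter j f x)
iter-+ zero    j f x = refl
iter-+ (suc i) j f x = cong f (iter-+ i j f x)

-- To be used with `τ` the translation by a vector over the field with `suc q` elements, where an
-- orbit inside `X` is a line inside `X`.
module Growth {V : Set} (_≟V_ : DecidableEquality V) (q : ℕ) (τ : V → V)
  (periodic : ∀ x → iter (suc q) τ x ≡ x) where

  open DecMembership _≟V_ using (_∈?_)

  new : List V → List V
  new X = filter (λ y → ¬? (y ∈? X)) (map τ X)

  grow : List V → List V
  grow X = X ++ new X

  τ-injective : ∀ {x y} → τ x ≡ τ y → x ≡ y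
  τ-injective {x} {y} e = begin
    x                ≡⟨ unshift x ⟨
    iter q τ (τ x)   ≡⟨ cong (iter q τ) e ⟩
    iter q τ (τ y)   ≡⟨ unshift y ⟩
    y                ∎
    where
    open ≡-Reasoning
    unshift : ∀ z → iter q τ (τ z) ≡ z
    unshift z = trans (sym (iter-+ q 1 τ z)) (trans (cong (λ i → iter i τ z) (+-comm q 1)) (periodic z))

  unique-grow : ∀ {X} → Unique X → Unique (grow X)
  unique-grow {X} u = Unique.++⁺ u
    (Unique.filter⁺ (λ y → ¬? (y ∈? X)) (Unique.map⁺ τ-injective u))
    (λ (a , b) → proj₂ (∈-filter⁻ (λ y → ¬? (y ∈? X)) {xs = map τ X} b) a)

  ∈-grow⁻ : ∀ {X z} → z ∈ grow X → z ∈ X ⊎ ∃ λ x → x ∈ X × z ≡ τ x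
  ∈-grow⁻ {X} z∈ with ∈-++⁻ X z∈
  ... | inj₁ a = inj₁ a
  ... | inj₂ b = inj₂ (∈-map⁻ τ (proj₁ (∈-filter⁻ (λ y → ¬? (y ∈? X)) {xs = map τ X} b)))

  ∈-new⁺ : ∀ {X x} → x ∈ X → τ x ∉ X → τ x ∈ new X
  ∈-new⁺ {X} x∈ τx∉ = ∈-filter⁺ (λ y → ¬? (y ∈? X)) (∈-map⁺ τ x∈) τx∉

  -- The first iterate outside `X` is the image of a point that is still in `X`, which is what
  -- membership in `new X` requires.
  orbit-end : ∀ {X x} k → x ∈ X → (∀ i → i ≤ k → iter i τ x ∈ X) ⊎
    ∃ λ i → i < k × iter (suc i) τ x ∈ new X
  orbit-end zero x∈ = inj₁ λ { zero _ → x∈ }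
  orbit-end {X} {x} (suc k) x∈ with orbit-end k x∈
  ... | inj₂ (i , i<k , y∈) = inj₂ (i , m≤n⇒m≤1+n i<k , y∈)
  ... | inj₁ all with iter (suc k) τ x ∈? X
  ...   | no y∉ = inj₂ (k , ≤-refl , ∈-new⁺ (all k ≤-refl) y∉)
  ...   | yes y∈ = inj₁ λ i i≤ → case i i≤ (m≤n⇒m<n∨m≡n i≤)
    where
    case : ∀ i → i ≤ suc k → i < suc k ⊎ i ≡ suc k → iter i τ x ∈ X
    case i _ (inj₁ (s≤s i≤k)) = all i i≤k
    case i _ (inj₂ refl)      = y∈

  -- The list `Y` still to be inspected is kept apart from the fixed set `X` in which the orbits are
  -- followed, so that induction on `Y` is possible.
  scan : ∀ {X} Y → (∀ {x} → x ∈ Y → x ∈ X) →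
    (∃ λ x → ∀ i → i ≤ q → iter i τ x ∈ X) ⊎
    (∀ {x} → x ∈ Y → ∃ λ i → i < q × iter (suc i) τ x ∈ new X)
  scan [] sub = inj₂ λ ()
  scan (x ∷ Y) sub with orbit-end q (sub (here refl)) | scan Y (sub ∘ there)
  ... | inj₁ all | _       = inj₁ (x , all)
  ... | inj₂ _   | inj₁ r  = inj₁ r
  ... | inj₂ e   | inj₂ es = inj₂ λ { (here refl) → e ; (there z∈) → es z∈ }

  -- Every point of X is the translate by one of q shifts of a point of new X:
  -- the one at which its orbit leaves X.
  orbit-or-growth : ∀ {X} → Unique X →
    (∃ λ x → ∀ i → i ≤ q → iter i τ x ∈ X) ⊎ (suc q * length X ≤ q * length (grow X))
  orbit-or-growth {X} u with scan X (λ z → z)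
  ... | inj₁ r = inj₁ r
  ... | inj₂ exits = inj₂ (begin
    length X + q * length X                 ≡⟨ +-comm (length X) _ ⟩
    q * length X + length X                 ≤⟨ +-monoʳ-≤ (q * length X) X≤ ⟩
    q * length X + q * length (new X)       ≡⟨ *-distribˡ-+ q (length X) _ ⟨
    q * (length X + length (new X))         ≡⟨ cong (q *_) (length-++ X) ⟨
    q * length (grow X)                     ∎)
    where
    open ≤-Reasoning
    back : ℕ → V → V
    back i y = iter (q ∸ i) τ y
    cover : ∀ {x} → x ∈ X → x ∈ cartesianProductWith back (upTo q) (new X)
    cover {x} x∈ with exits x∈
    ... | i , i<q , y∈ = subst (_∈ _) eq (∈-cartesianProductWith⁺ back (∈-upTo⁺ i<q) y∈)
      where
      eq : iter (q ∸ i) τ (iter (suc i) τ x) ≡ x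
      -- After `suc i` steps away from `x`, another `q ∸ i` steps complete the period `suc q`.
      eq = trans (sym (iter-+ (q ∸ i) (suc i) τ x))
        (trans (cong (λ k → iter k τ x) (trans (+-suc (q ∸ i) i) (cong suc (m∸n+n≡m (<⇒≤ i<q))))) (periodic x))
    X≤ : length X ≤ q * length (new X)
    X≤ = ≤-trans (unique-⊆⇒length≤ u cover) (≤-reflexive
      (trans (length-cartesianProductWith back (upTo q) (new X)) (cong (_* length (new X)) (length-upTo q))))

-- Finite fields

-- The theory is developed over abstract operations, because those of Defs unfold to arithmetic
-- modulo p and then block unification. ΣF and bit are fields, so that the notions below specialise
-- definitionally to those of Defs.
record FiniteField (p : ℕ) : Set where
  infixl 6 _+F_
  infixl 7 _*F_
  infix 8 -F_
  field
    0F 1F             : Fin p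
    _+F_ _*F_         : Fin p → Fin p → Fin p
    -F_               : Fin p → Fin p
    isCommutativeRing : IsCommutativeRing _≡_ _+F_ _*F_ -F_ 0F 1F
    0F≢1F             : 0F ≢ 1F
    inverse           : ∀ {a} → a ≢ 0F → ∃ λ b → b *F a ≡ 1F
    fromℕ             : ℕ → Fin p
    fromℕ-zero        : fromℕ 0 ≡ 0F
    fromℕ-suc         : ∀ m → fromℕ (suc m) ≡ 1F +F fromℕ m
    fromℕ-p           : fromℕ p ≡ 0F
    fromℕ-toℕ         : ∀ a → fromℕ (toℕ a) ≡ a
    bit               : Bool → Fin p
    bit-false         : bit false ≡ 0F
    bit-true          : bit true ≡ 1F
    ΣF                : ∀ {n} → (Fin n → Fin p) → Fin p
    ΣF-[]             : (v : Fin 0 → Fin p) → ΣF v ≡ 0F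
    ΣF-∷              : ∀ {n} (v : Fin (suc n) → Fin p) → ΣF v ≡ v fz +F ΣF (λ i → v (fs i))

module FieldLaws (p : ℕ) .{{_ : NonZero p}} (prime : Prime p) where

  open Field p

  infix 8 -F_

  -F_ : 𝔽 → 𝔽
  -F a = (p ∸ toℕ a) mod p

  toℕ-mod : ∀ m → toℕ (m mod p) ≡ m % p
  toℕ-mod m = toℕ-fromℕ< _

  mod-cong : ∀ {m n} → m % p ≡ n % p → m mod p ≡ n mod p
  mod-cong {m} {n} e = toℕ-injective (trans (toℕ-mod m) (trans e (sym (toℕ-mod n))))

  mod-toℕ : ∀ a → toℕ a mod p ≡ a
  mod-toℕ a = toℕ-injective (trans (toℕ-mod (toℕ a)) (m<n⇒m%n≡m (toℕ<n a)))

  -- Together with `mod-*` and `mod-toℕ` this transfers associativity and distributivity from the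
  -- natural numbers: every element is first written as a residue.
  mod-+ : ∀ m n → (m mod p) +F (n mod p) ≡ (m + n) mod p
  mod-+ m n = mod-cong (trans (cong₂ (λ x y → (x + y) % p) (toℕ-mod m) (toℕ-mod n)) (sym (%-distribˡ-+ m n p)))

  mod-* : ∀ m n → (m mod p) *F (n mod p) ≡ (m * n) mod p
  mod-* m n = mod-cong (trans (cong₂ (λ x y → (x * y) % p) (toℕ-mod m) (toℕ-mod n)) (sym (%-distribˡ-* m n p)))

  +F-comm : ∀ a b → a +F b ≡ b +F a
  +F-comm a b = cong (_mod p) (+-comm (toℕ a) (toℕ b))

  *F-comm : ∀ a b → a *F b ≡ b *F a
  *F-comm a b = cong (_mod p) (*-comm (toℕ a) (toℕ b))

  +F-assoc : ∀ a b c → (a +F b) +F c ≡ a +F (b +F c)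
  +F-assoc a b c = begin
    (a +F b) +F c                       ≡⟨ cong ((a +F b) +F_) (mod-toℕ c) ⟨
    (a +F b) +F (toℕ c mod p)           ≡⟨ mod-+ (toℕ a + toℕ b) (toℕ c) ⟩
    (toℕ a + toℕ b + toℕ c) mod p       ≡⟨ cong (_mod p) (+-assoc (toℕ a) (toℕ b) (toℕ c)) ⟩
    (toℕ a + (toℕ b + toℕ c)) mod p     ≡⟨ mod-+ (toℕ a) (toℕ b + toℕ c) ⟨
    (toℕ a mod p) +F (b +F c)           ≡⟨ cong (_+F (b +F c)) (mod-toℕ a) ⟩
    a +F (b +F c)                       ∎
    where open ≡-Reasoning

  *F-assoc : ∀ a b c → (a *F b) *F c ≡ a *F (b *F c)
  *F-assoc a b c = begin
    (a *F b) *F c                       ≡⟨ cong ((a *F b) *F_) (mod-toℕ c) ⟨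
    (a *F b) *F (toℕ c mod p)           ≡⟨ mod-* (toℕ a * toℕ b) (toℕ c) ⟩
    (toℕ a * toℕ b * toℕ c) mod p       ≡⟨ cong (_mod p) (*-assoc (toℕ a) (toℕ b) (toℕ c)) ⟩
    (toℕ a * (toℕ b * toℕ c)) mod p     ≡⟨ mod-* (toℕ a) (toℕ b * toℕ c) ⟨
    (toℕ a mod p) *F (b *F c)           ≡⟨ cong (_*F (b *F c)) (mod-toℕ a) ⟩
    a *F (b *F c)                       ∎
    where open ≡-Reasoning

  *F-distribˡ : ∀ a b c → a *F (b +F c) ≡ (a *F b) +F (a *F c)
  *F-distribˡ a b c = begin
    a *F (b +F c)                             ≡⟨ cong (_*F (b +F c)) (mod-toℕ a) ⟨
    (toℕ a mod p) *F (b +F c)                 ≡⟨ mod-* (toℕ a) (toℕ b + toℕ c) ⟩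
    (toℕ a * (toℕ b + toℕ c)) mod p           ≡⟨ cong (_mod p) (*-distribˡ-+ (toℕ a) (toℕ b) (toℕ c)) ⟩
    (toℕ a * toℕ b + toℕ a * toℕ c) mod p     ≡⟨ mod-+ (toℕ a * toℕ b) (toℕ a * toℕ c) ⟨
    (a *F b) +F (a *F c)                      ∎
    where open ≡-Reasoning

  *F-distribʳ : ∀ a b c → (b +F c) *F a ≡ (b *F a) +F (c *F a)
  *F-distribʳ a b c = trans (*F-comm (b +F c) a)
    (trans (*F-distribˡ a b c) (cong₂ _+F_ (*F-comm a b) (*F-comm a c)))

  +F-identityˡ : ∀ a → 0F +F a ≡ a
  +F-identityˡ a = trans (cong (0F +F_) (sym (mod-toℕ a))) (trans (mod-+ 0 (toℕ a)) (mod-toℕ a))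

  *F-identityˡ : ∀ a → 1F *F a ≡ a
  *F-identityˡ a = trans (cong (1F *F_) (sym (mod-toℕ a)))
    (trans (mod-* 1 (toℕ a)) (trans (cong (_mod p) (*-identityˡ (toℕ a))) (mod-toℕ a)))

  p-mod : p mod p ≡ 0F
  p-mod = mod-cong (trans (n%n≡0 p) (sym (m*n%n≡0 0 p)))

  -F-inverseʳ : ∀ a → a +F (-F a) ≡ 0F
  -F-inverseʳ a = begin
    a +F (-F a)                       ≡⟨ cong (_+F (-F a)) (mod-toℕ a) ⟨
    (toℕ a mod p) +F (-F a)           ≡⟨ mod-+ (toℕ a) (p ∸ toℕ a) ⟩
    (toℕ a + (p ∸ toℕ a)) mod p       ≡⟨ cong (_mod p) (m+[n∸m]≡n (<⇒≤ (toℕ<n a))) ⟩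
    p mod p                           ≡⟨ p-mod ⟩
    0F                                ∎
    where open ≡-Reasoning

  isCommutativeRing : IsCommutativeRing _≡_ _+F_ _*F_ -F_ 0F 1F
  isCommutativeRing = record
    { isRing = record
      { +-isAbelianGroup = record
        { isGroup = record
          { isMonoid = record
            { isSemigroup = record
              { isMagma = record { isEquivalence = isEquivalence ; ∙-cong = cong₂ _+F_ }
              ; assoc = +F-assoc }
            ; identity = +F-identityˡ , λ a → trans (+F-comm a 0F) (+F-identityˡ a) }
          ; inverse = (λ a → trans (+F-comm (-F a) a) (-F-inverseʳ a)) , -F-inverseʳ
          ; ⁻¹-cong = cong -F_ }
        ; comm = +F-comm }
      ; *-cong = cong₂ _*F_
      ; *-assoc = *F-assoc
      ; *-identity = *F-identityˡ , λ a → trans (*F-comm a 1F) (*F-identityˡ a)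
      ; distrib = *F-distribˡ , *F-distribʳ }
    ; *-comm = *F-comm }

  commutativeRing : CommutativeRing _ _
  commutativeRing = record { isCommutativeRing = isCommutativeRing }

  0F≢1F : 0F ≢ 1F
  0F≢1F e with trans (sym (m<n⇒m%n≡m {n = p} 1<p)) (trans (sym (toℕ-mod 1)) (trans (cong toℕ (sym e))
    (trans (toℕ-mod 0) (m<n⇒m%n≡m {n = p} (<-trans (s≤s z≤n) 1<p)))))
    where
    1<p : 1 < p
    1<p = nonTrivial⇒n>1 p {{prime⇒nonTrivial prime}}
  ... | ()

  -- Bézout's identity for the coprime numbers p and `toℕ a` has two forms over the natural numbers.
  -- If 1 + xp = ya, the inverse is y; if 1 + ya = xp, it is -y, which is checked by adding ya to
  -- both sides.
  inverse : ∀ {a} → a ≢ 0F → ∃ λ b → b *F a ≡ 1F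
  inverse {a} a≢0 with coprime-Bézout (prime⇒coprime prime {{≢-nonZero toℕa≢0}} (toℕ<n a))
    where
    toℕa≢0 : toℕ a ≢ 0
    toℕa≢0 e = a≢0 (trans (sym (mod-toℕ a)) (cong (_mod p) e))
  ... | Bézout.-+ x y eq = y mod p , (begin
    (y mod p) *F a                ≡⟨ cong ((y mod p) *F_) (mod-toℕ a) ⟨
    (y mod p) *F (toℕ a mod p)    ≡⟨ mod-* y (toℕ a) ⟩
    (y * toℕ a) mod p             ≡⟨ cong (_mod p) eq ⟨
    (1 + x * p) mod p             ≡⟨ mod-cong ([m+kn]%n≡m%n 1 x p) ⟩
    1F                            ∎)
    where open ≡-Reasoning
  ... | Bézout.+- x y eq = (-F (y mod p)) , GroupProps.∙-cancelˡ (CommutativeRing.+-group commutativeRing) ((y mod p) *F a) _ _ (begin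
    ((y mod p) *F a) +F ((-F (y mod p)) *F a)   ≡⟨ *F-distribʳ a (y mod p) (-F (y mod p)) ⟨
    ((y mod p) +F (-F (y mod p))) *F a          ≡⟨ cong (_*F a) (-F-inverseʳ (y mod p)) ⟩
    0F *F a                                     ≡⟨ CommutativeRing.zeroˡ commutativeRing a ⟩
    0F                                          ≡⟨ mod-cong (trans (m*n%n≡0 0 p) (sym (m*n%n≡0 x p))) ⟩
    (x * p) mod p                               ≡⟨ cong (_mod p) (trans (sym eq) (+-comm 1 _)) ⟩
    (y * toℕ a + 1) mod p                       ≡⟨ mod-+ (y * toℕ a) 1 ⟨
    ((y * toℕ a) mod p) +F 1F                   ≡⟨ cong (_+F 1F) (mod-* y (toℕ a)) ⟨
    ((y mod p) *F (toℕ a mod p)) +F 1F          ≡⟨ cong (λ z → ((y mod p) *F z) +F 1F) (mod-toℕ a) ⟩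
    ((y mod p) *F a) +F 1F                      ∎)
    where open ≡-Reasoning

  finiteField : FiniteField p
  finiteField = record
    { isCommutativeRing = isCommutativeRing
    ; 0F≢1F      = 0F≢1F
    ; inverse    = inverse
    ; fromℕ      = _mod p
    ; fromℕ-zero = refl
    ; fromℕ-suc  = λ m → sym (mod-+ 1 m)
    ; fromℕ-p    = p-mod
    ; fromℕ-toℕ  = mod-toℕ
    ; bit        = bool→𝔽
    ; bit-false  = refl
    ; bit-true   = refl
    ; ΣF         = ΣF
    ; ΣF-[]      = λ _ → refl
    ; ΣF-∷       = λ _ → refl }

module FieldTheory {p : ℕ} (K : FiniteField p) where

  open FiniteField K public

  𝔽 : Set
  𝔽 = Fin p

  Vecₚ : ℕ → Set
  Vecₚ n = Fin n → 𝔽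

  IsZeroVec : ∀ {n} → Vecₚ n → Set
  IsZeroVec v = ∀ j → v j ≡ 0F

  commutativeRing : CommutativeRing _ _
  commutativeRing = record { isCommutativeRing = isCommutativeRing }

  open CommutativeRing commutativeRing public using () renaming
    ( +-comm to +F-comm ; +-assoc to +F-assoc ; +-identityˡ to +F-identityˡ ; +-identityʳ to +F-identityʳ
    ; *-comm to *F-comm ; *-assoc to *F-assoc ; *-identityˡ to *F-identityˡ ; *-identityʳ to *F-identityʳ
    ; distribˡ to *F-distribˡ ; distribʳ to *F-distribʳ ; zeroˡ to *F-zeroˡ ; zeroʳ to *F-zeroʳ
    ; -‿inverseʳ to -F-inverseʳ )

  ring : AlmostCommutativeRing _ _
  ring = fromCommutativeSemiring (CommutativeRing.commutativeSemiring commutativeRing) (λ _ → nothing)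

  open AlmostCommutativeRing ring public using () renaming (_+_ to _⊕_; _*_ to _⊗_; _≈_ to _≈R_)

  +F-cancelˡ : ∀ a {b c} → a +F b ≡ a +F c → b ≡ c
  +F-cancelˡ a {b} {c} = GroupProps.∙-cancelˡ (CommutativeRing.+-group commutativeRing) a b c

  +F-solve : ∀ a b → (a +F (-F b)) +F b ≡ a
  +F-solve a b = trans (+F-assoc a (-F b) b)
    (trans (cong (a +F_) (trans (+F-comm (-F b) b) (-F-inverseʳ b))) (+F-identityʳ a))

  *F-cancelˡ-0 : ∀ {a b} → a ≢ 0F → a *F b ≡ 0F → b ≡ 0F
  *F-cancelˡ-0 {a} {b} a≢0 e with inverse a≢0
  ... | c , ca≡1 = begin
    b                ≡⟨ *F-identityˡ b ⟨
    1F *F b          ≡⟨ cong (_*F b) ca≡1 ⟨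
    (c *F a) *F b    ≡⟨ *F-assoc c a b ⟩
    c *F (a *F b)    ≡⟨ cong (c *F_) e ⟩
    c *F 0F          ≡⟨ *F-zeroʳ c ⟩
    0F               ∎
    where open ≡-Reasoning

  *F-cancelʳ-0 : ∀ {a b} → b ≢ 0F → a *F b ≡ 0F → a ≡ 0F
  *F-cancelʳ-0 {a} {b} b≢0 e = *F-cancelˡ-0 b≢0 (trans (*F-comm b a) e)

  ΣF-cong : ∀ {n} {u v : Vecₚ n} → (∀ i → u i ≡ v i) → ΣF u ≡ ΣF v
  ΣF-cong {zero}  {u} {v} e = trans (ΣF-[] u) (sym (ΣF-[] v))
  ΣF-cong {suc n} {u} {v} e = trans (ΣF-∷ u)
    (trans (cong₂ _+F_ (e fz) (ΣF-cong (λ i → e (fs i)))) (sym (ΣF-∷ v)))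

  ΣF-zero : ∀ {n} {v : Vecₚ n} → IsZeroVec v → ΣF v ≡ 0F
  ΣF-zero {zero}  {v} z = ΣF-[] v
  ΣF-zero {suc n} {v} z = trans (ΣF-∷ v) (trans (cong₂ _+F_ (z fz) (ΣF-zero (λ i → z (fs i)))) (+F-identityˡ 0F))

  +F-interchange : ∀ a b c d → (a ⊕ b) ⊕ (c ⊕ d) ≈R (a ⊕ c) ⊕ (b ⊕ d)
  +F-interchange = solve-∀ ring

  ΣF-+ : ∀ {n} (u v : Vecₚ n) → ΣF (λ i → u i +F v i) ≡ ΣF u +F ΣF v
  ΣF-+ {zero}  u v = trans (ΣF-[] _) (sym (trans (cong₂ _+F_ (ΣF-[] u) (ΣF-[] v)) (+F-identityˡ 0F)))
  ΣF-+ {suc n} u v = trans (ΣF-∷ _) (trans (cong ((u fz +F v fz) +F_) (ΣF-+ (λ i → u (fs i)) (λ i → v (fs i))))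
    (trans (+F-interchange (u fz) (v fz) _ _) (sym (cong₂ _+F_ (ΣF-∷ u) (ΣF-∷ v)))))

  ΣF-*ˡ : ∀ {n} a (v : Vecₚ n) → ΣF (λ i → a *F v i) ≡ a *F ΣF v
  ΣF-*ˡ {zero}  a v = trans (ΣF-[] _) (sym (trans (cong (a *F_) (ΣF-[] v)) (*F-zeroʳ a)))
  ΣF-*ˡ {suc n} a v = trans (ΣF-∷ _) (trans (cong ((a *F v fz) +F_) (ΣF-*ˡ a (λ i → v (fs i))))
    (sym (trans (cong (a *F_) (ΣF-∷ v)) (*F-distribˡ a _ _))))

  ΣF-*ʳ : ∀ {n} a (v : Vecₚ n) → ΣF (λ i → v i *F a) ≡ ΣF v *F a
  ΣF-*ʳ a v = trans (ΣF-cong (λ i → *F-comm (v i) a)) (trans (ΣF-*ˡ a v) (*F-comm a (ΣF v)))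

  ΣF-swap : ∀ {m n} (M : Fin m → Fin n → 𝔽) → ΣF (λ i → ΣF (λ j → M i j)) ≡ ΣF (λ j → ΣF (λ i → M i j))
  ΣF-swap {zero}  {n} M = trans (ΣF-[] _) (sym (ΣF-zero {n} (λ j → ΣF-[] _)))
  ΣF-swap {suc m} M = trans (ΣF-∷ _) (trans (cong (ΣF (M fz) +F_) (ΣF-swap (λ i → M (fs i))))
    (trans (sym (ΣF-+ (M fz) (λ j → ΣF (λ i → M (fs i) j)))) (ΣF-cong λ j → sym (ΣF-∷ (λ i → M i j)))))

  ΣF-single : ∀ {n} {v : Vecₚ n} i → (∀ j → i ≢ j → v j ≡ 0F) → ΣF v ≡ v i
  ΣF-single {v = v} fz     z = trans (ΣF-∷ v) (trans (cong (v fz +F_) (ΣF-zero (λ j → z (fs j) λ ()))) (+F-identityʳ _))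
  ΣF-single {v = v} (fs i) z = trans (ΣF-∷ v) (trans (cong₂ _+F_ (z fz λ ())
    (ΣF-single i (λ j i≢j → z (fs j) (λ e → i≢j (suc-injective e))))) (+F-identityˡ _))

  rearrange : ∀ x k t wᵢ y → x ⊕ (k ⊗ ((t ⊗ wᵢ) ⊕ y)) ≈R (k ⊗ y) ⊕ (x ⊕ (t ⊗ (k ⊗ wᵢ)))
  rearrange = solve-∀ ring

  collect : ∀ x t k w → (x ⊕ (t ⊗ k)) ⊕ (t ⊗ w) ≈R x ⊕ (t ⊗ (k ⊕ w))
  collect = solve-∀ ring

  +F-rotate : ∀ v x y → v ⊕ (x ⊕ y) ≈R x ⊕ (v ⊕ y)
  +F-rotate = solve-∀ ring

-- Linear algebra

∧-true : ∀ {a b} → a ∧ b ≡ true → a ≡ true × b ≡ true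
∧-true {true} {true} _ = refl , refl

∧-intro : ∀ {a b} → a ≡ true → b ≡ true → a ∧ b ≡ true
∧-intro refl refl = refl

not-true : ∀ {b} → b ≢ true → b ≡ false
not-true {true}  h = contradiction refl h
not-true {false} h = refl

not-false : ∀ {b} → b ≢ false → b ≡ true
not-false {true}  h = refl
not-false {false} h = contradiction refl h

module Linear {p : ℕ} (K : FiniteField p) where

  open FieldTheory K

  Matrix : ℕ → ℕ → Set
  Matrix r n = Fin r → Fin n → 𝔽

  evalF : ∀ {n} → Vecₚ n → Vecₚ n → 𝔽
  evalF f x = ΣF (λ j → f j *F x j)

  infixl 7 _·ᵣ_ _·ᶜ_

  _·ᵣ_ : ∀ {r n} → Vecₚ r → Matrix r n → Vecₚ n
  (c ·ᵣ F) j = evalF c (λ i → F i j)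

  _·ᶜ_ : ∀ {r n} → Matrix r n → Vecₚ n → Vecₚ r
  (F ·ᶜ x) i = evalF (F i) x

  infixl 6 _⊹_
  infixl 7 _✶_

  _⊹_ : ∀ {n} → Vecₚ n → Vecₚ n → Vecₚ n
  (u ⊹ v) i = u i +F v i

  _✶_ : ∀ {n} → 𝔽 → Vecₚ n → Vecₚ n
  (κ ✶ v) i = κ *F v i

  at : ∀ {n} → Fin n → 𝔽 → Vecₚ n
  at i κ l = if does (i ≟ l) then κ else 0F

  at-self : ∀ {n} (i : Fin n) κ → at i κ i ≡ κ
  at-self i κ with i ≟ i
  ... | yes _  = refl
  ... | no i≢i = contradiction refl i≢i

  at-other : ∀ {n} {i l : Fin n} κ → i ≢ l → at i κ l ≡ 0F
  at-other {i = i} {l} κ i≢l with i ≟ l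
  ... | yes i≡l = contradiction i≡l i≢l
  ... | no _    = refl

  evalF-cong : ∀ {n} {f g x y : Vecₚ n} → (∀ j → f j ≡ g j) → (∀ j → x j ≡ y j) → evalF f x ≡ evalF g y
  evalF-cong e e′ = ΣF-cong λ j → cong₂ _*F_ (e j) (e′ j)

  evalF-⊹ˡ : ∀ {n} (f g x : Vecₚ n) → evalF (f ⊹ g) x ≡ evalF f x +F evalF g x
  evalF-⊹ˡ f g x = trans (ΣF-cong λ j → *F-distribʳ (x j) (f j) (g j)) (ΣF-+ _ _)

  evalF-⊹ʳ : ∀ {n} (f x y : Vecₚ n) → evalF f (x ⊹ y) ≡ evalF f x +F evalF f y
  evalF-⊹ʳ f x y = trans (ΣF-cong λ j → *F-distribˡ (f j) (x j) (y j)) (ΣF-+ _ _)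

  evalF-✶ˡ : ∀ {n} κ (f x : Vecₚ n) → evalF (κ ✶ f) x ≡ κ *F evalF f x
  evalF-✶ˡ κ f x = trans (ΣF-cong λ j → *F-assoc κ (f j) (x j)) (ΣF-*ˡ κ _)

  evalF-at : ∀ {n} (i : Fin n) κ (x : Vecₚ n) → evalF (at i κ) x ≡ κ *F x i
  evalF-at i κ x = trans
    (ΣF-single i λ j i≢j → trans (cong (_*F x j) (at-other κ i≢j)) (*F-zeroˡ (x j)))
    (cong (_*F x i) (at-self i κ))

  evalF-comm : ∀ {n} (f x : Vecₚ n) → evalF f x ≡ evalF x f
  evalF-comm f x = ΣF-cong λ j → *F-comm (f j) (x j)

  evalF-·ᵣ : ∀ {r n} (c : Vecₚ r) (F : Matrix r n) x → evalF (c ·ᵣ F) x ≡ evalF c (F ·ᶜ x)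
  evalF-·ᵣ c F x = begin
    ΣF (λ j → ΣF (λ i → c i *F F i j) *F x j)     ≡⟨ ΣF-cong (λ j → ΣF-*ʳ (x j) _) ⟨
    ΣF (λ j → ΣF (λ i → (c i *F F i j) *F x j))   ≡⟨ ΣF-swap (λ j i → (c i *F F i j) *F x j) ⟩
    ΣF (λ i → ΣF (λ j → (c i *F F i j) *F x j))   ≡⟨ ΣF-cong (λ i → ΣF-cong λ j → *F-assoc (c i) (F i j) (x j)) ⟩
    ΣF (λ i → ΣF (λ j → c i *F (F i j *F x j)))   ≡⟨ ΣF-cong (λ i → ΣF-*ˡ (c i) _) ⟩
    ΣF (λ i → c i *F (F ·ᶜ x) i)                  ∎
    where open ≡-Reasoning

  Supp : ∀ {r} → (Fin r → Bool) → Vecₚ r → Set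
  Supp mask c = ∀ i → mask i ≡ false → c i ≡ 0F

  evalF-supp : ∀ {r} {mask : Fin r → Bool} {c x y : Vecₚ r} → Supp mask c →
    (∀ i → mask i ≡ true → x i ≡ y i) → evalF c x ≡ evalF c y
  evalF-supp {mask = mask} {c} {x} {y} supp e = ΣF-cong eq
    where
    eq : ∀ i → c i *F x i ≡ c i *F y i
    eq i with mask i in m
    ... | true  = cong (c i *F_) (e i m)
    ... | false rewrite supp i m = trans (*F-zeroˡ (x i)) (sym (*F-zeroˡ (y i)))

  nz : 𝔽 → Bool
  nz a = not (does (a ≟ 0F))

  nz-intro : ∀ {a} → a ≢ 0F → nz a ≡ true
  nz-intro {a} a≢0 with a ≟ 0F
  ... | yes e = contradiction e a≢0
  ... | no _  = refl

  nz-elim : ∀ {a} → nz a ≡ true → a ≢ 0F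
  nz-elim {a} e with a ≟ 0F
  ... | no a≢0 = a≢0

  ¬nz : ∀ {a} → nz a ≡ false → a ≡ 0F
  ¬nz {a} e with a ≟ 0F
  ... | yes z = z

  wt : ∀ {n} → (Fin n → Bool) → Vecₚ n → ℕ
  wt free v = count (λ j → free j ∧ nz (v j))

  wt-mono : ∀ {n} {free : Fin n → Bool} {u v : Vecₚ n} →
    (∀ j → free j ≡ true → v j ≡ 0F → u j ≡ 0F) → wt free u ≤ wt free v
  wt-mono h = count-mono λ j e → let m , u≢0 = ∧-true e in
    ∧-intro m (nz-intro λ v≡0 → nz-elim u≢0 (h j m v≡0))

  wt-vanish : ∀ {n} {free : Fin n → Bool} {v : Vecₚ n} →
    (∀ j → free j ≡ true → v j ≡ 0F) → wt free v ≡ 0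
  wt-vanish {n} {free} {v} h = n≤0⇒n≡0 (≤-trans
    (count-mono {Q = λ _ → false} λ j e → let m , v≢0 = ∧-true e in contradiction (h j m) (nz-elim v≢0))
    (≤-reflexive (count-none {n})))

  -- The row operations that clear column w against its pivot entry w i.
  module Elimination {r} (mask : Fin r → Bool) (i : Fin r) (mask-i : mask i ≡ true)
    (w : Vecₚ r) (wᵢ≢0 : w i ≢ 0F) where

    private
      v : 𝔽
      v = proj₁ (inverse wᵢ≢0)

      v*wᵢ : v *F w i ≡ 1F
      v*wᵢ = proj₂ (inverse wᵢ≢0)

    κ : Vecₚ r
    κ l = -F (w l *F v)

    κ*wᵢ : ∀ l → (κ l *F w i) +F w l ≡ 0F
    κ*wᵢ l = begin
      (κ l *F w i) +F w l                        ≡⟨ cong ((κ l *F w i) +F_) (*F-identityʳ (w l)) ⟨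
      (κ l *F w i) +F (w l *F 1F)                ≡⟨ cong (λ z → (κ l *F w i) +F (w l *F z)) v*wᵢ ⟨
      (κ l *F w i) +F (w l *F (v *F w i))        ≡⟨ cong ((κ l *F w i) +F_) (*F-assoc (w l) v (w i)) ⟨
      (κ l *F w i) +F ((w l *F v) *F w i)        ≡⟨ *F-distribʳ (w i) (κ l) (w l *F v) ⟨
      (κ l +F (w l *F v)) *F w i                 ≡⟨ cong (_*F w i) (trans (+F-comm _ _) (-F-inverseʳ (w l *F v))) ⟩
      0F *F w i                                  ≡⟨ *F-zeroˡ (w i) ⟩
      0F                                         ∎
      where open ≡-Reasoning

    -- Row `i` itself becomes zero, as `κ i` is -1; from here on only the rows of `mask ∖ i` are
    -- considered.
    elim : ∀ {n} → Matrix r n → Matrix r n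
    elim F l = F l ⊹ (κ l ✶ F i)

    elimᵥ : Vecₚ r → Vecₚ r
    elimᵥ a l = a l +F (κ l *F a i)

    -- The transpose of `elimᵥ`, acting on coefficient vectors.
    pullback : Vecₚ r → Vecₚ r
    pullback c = c ⊹ at i (evalF c κ)

    ·ᵣ-elim : ∀ {n} (c : Vecₚ r) (F : Matrix r n) j → (c ·ᵣ elim F) j ≡ (pullback c ·ᵣ F) j
    ·ᵣ-elim c F j = begin
      evalF c (λ l → F l j +F (κ l *F F i j))                      ≡⟨ evalF-⊹ʳ c (λ l → F l j) (λ l → κ l *F F i j) ⟩
      (c ·ᵣ F) j +F ΣF (λ l → c l *F (κ l *F F i j))               ≡⟨ cong ((c ·ᵣ F) j +F_) (ΣF-cong λ l → *F-assoc (c l) (κ l) (F i j)) ⟨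
      (c ·ᵣ F) j +F ΣF (λ l → (c l *F κ l) *F F i j)               ≡⟨ cong ((c ·ᵣ F) j +F_) (ΣF-*ʳ (F i j) _) ⟩
      (c ·ᵣ F) j +F (evalF c κ *F F i j)                           ≡⟨ cong ((c ·ᵣ F) j +F_) (evalF-at i (evalF c κ) (λ l → F l j)) ⟨
      (c ·ᵣ F) j +F (at i (evalF c κ) ·ᵣ F) j                      ≡⟨ evalF-⊹ˡ c (at i (evalF c κ)) (λ l → F l j) ⟨
      (pullback c ·ᵣ F) j                                          ∎
      where open ≡-Reasoning

    evalF-elim : ∀ {n} (F : Matrix r n) x l → evalF (elim F l) x ≡ elimᵥ (F ·ᶜ x) l
    evalF-elim F x l = trans (evalF-⊹ˡ (F l) (κ l ✶ F i) x) (cong (evalF (F l) x +F_) (evalF-✶ˡ (κ l) (F i) x))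

    pullback-supp : ∀ {c} → Supp (mask ∖ i) c → Supp mask (pullback c)
    pullback-supp {c} supp l m = trans (cong₂ _+F_
        (supp l (not-true λ e → contradiction (trans (sym m) (proj₁ (∖-true mask {i} {l} e))) λ ()))
        (at-other {i = i} {l} (evalF c κ) λ { refl → contradiction (trans (sym m) mask-i) λ () }))
      (+F-identityˡ 0F)

    pullback-zero : ∀ {c} → Supp (mask ∖ i) c → IsZeroVec (pullback c) → IsZeroVec c
    pullback-zero {c} supp z l with i ≟ l
    ... | yes refl = supp l (∖-self mask l)
    ... | no i≢l   = trans (sym (+F-identityʳ (c l)))
      (trans (cong (c l +F_) (sym (at-other (evalF c κ) i≢l))) (z l))

    -- `elimᵥ` is the quotient by the direction `w`, read off in the rows other than `i`. Vectors
    -- with the same image differ by a multiple of `w`, and row `i` determines the factor t = (α i -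
    -- β i) / w i.
    back-substitute : ∀ {α β} → (∀ l → (mask ∖ i) l ≡ true → elimᵥ β l ≡ elimᵥ α l) →
      ∃ λ t → ∀ l → mask l ≡ true → β l +F (t *F w l) ≡ α l
    back-substitute {α} {β} e = t , eq
      where
      open ≡-Reasoning
      t : 𝔽
      t = (α i +F (-F β i)) *F v
      t*wᵢ : (t *F w i) +F β i ≡ α i
      t*wᵢ = begin
        (t *F w i) +F β i                               ≡⟨ cong (_+F β i) (*F-assoc _ v (w i)) ⟩
        ((α i +F (-F β i)) *F (v *F w i)) +F β i        ≡⟨ cong (λ z → ((α i +F (-F β i)) *F z) +F β i) v*wᵢ ⟩
        ((α i +F (-F β i)) *F 1F) +F β i                ≡⟨ cong (_+F β i) (*F-identityʳ _) ⟩
        (α i +F (-F β i)) +F β i                        ≡⟨ +F-solve (α i) (β i) ⟩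
        α i                                             ∎
      eq : ∀ l → mask l ≡ true → β l +F (t *F w l) ≡ α l
      eq l m with i ≟ l
      ... | yes refl = trans (+F-comm (β l) _) t*wᵢ
      ... | no i≢l   = begin
        β l +F (t *F w l)                                  ≡⟨ cong (_+F (t *F w l)) β≡ ⟩
        (α l +F (t *F (κ l *F w i))) +F (t *F w l)         ≡⟨ collect (α l) t (κ l *F w i) (w l) ⟩
        α l +F (t *F ((κ l *F w i) +F w l))                ≡⟨ cong (λ z → α l +F (t *F z)) (κ*wᵢ l) ⟩
        α l +F (t *F 0F)                                   ≡⟨ cong (α l +F_) (*F-zeroʳ t) ⟩
        α l +F 0F                                          ≡⟨ +F-identityʳ (α l) ⟩
        α l                                                ∎
        where
        β≡ : β l ≡ α l +F (t *F (κ l *F w i))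
        β≡ = +F-cancelˡ (κ l *F β i) (begin
          (κ l *F β i) +F β l                                   ≡⟨ +F-comm _ (β l) ⟩
          β l +F (κ l *F β i)                                   ≡⟨ e l (trans (∖-other mask i≢l) m) ⟩
          α l +F (κ l *F α i)                                   ≡⟨ cong (λ z → α l +F (κ l *F z)) t*wᵢ ⟨
          α l +F (κ l *F ((t *F w i) +F β i))                   ≡⟨ rearrange (α l) (κ l) t (w i) (β i) ⟩
          (κ l *F β i) +F (α l +F (t *F (κ l *F w i)))          ∎)

  at-supp : ∀ {r} {mask : Fin r → Bool} {i} κ → mask i ≡ true → Supp mask (at i κ)
  at-supp {i = i} κ m l m′ = at-other {i = i} {l} κ λ { refl → contradiction (trans (sym m) m′) λ () }

  -- A row that vanishes on `free` would make `at i 1F` a nontrivial combination vanishing there.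
  pivot : ∀ {r n} {mask : Fin r → Bool} {free : Fin n → Bool} {F : Matrix r n} →
    (∀ c → Supp mask c → (∀ j → free j ≡ true → (c ·ᵣ F) j ≡ 0F) → IsZeroVec c) →
    ∀ i → mask i ≡ true → ∃ λ j → free j ∧ nz (F i j) ≡ true
  pivot {free = free} {F} trivial i m with any? (λ j → free j ∧ nz (F i j) Bool.≟ true)
  ... | yes r = r
  ... | no ¬r = contradiction (sym (trans (sym (at-self i 1F))
    (trivial (at i 1F) (at-supp 1F m) (λ j f → trans (evalF-at i 1F (λ l → F l j))
      (trans (*F-identityˡ (F i j)) (¬nz (not-true λ e → ¬r (j , ∧-intro f e))))) i))) 0F≢1F

  -- Gaussian elimination, by recursion on a bound `N` for the number of rows. A column with a free
  -- pivot is cleared, the other rows are solved, and the pivot coordinate is then shifted by the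
  -- `t` of back substitution. Only free coordinates are ever moved away from `ρ`.
  solvable : ∀ N {r n} (mask : Fin r → Bool) → count mask ≤ N →
    (free : Fin n → Bool) (F : Matrix r n) (a : Vecₚ r) (ρ : Vecₚ n) →
    (∀ c → Supp mask c → (∀ j → free j ≡ true → (c ·ᵣ F) j ≡ 0F) → IsZeroVec c) →
    ∃ λ x → (∀ j → free j ≡ false → x j ≡ ρ j) × (∀ i → mask i ≡ true → evalF (F i) x ≡ a i)
  solvable N mask ≤N free F a ρ trivial with any? (λ i → mask i Bool.≟ true)
  ... | no none = ρ , (λ _ _ → refl) , λ i m → contradiction (i , m) none
  solvable zero mask ≤N free F a ρ trivial | yes (i , m) = contradiction (≤-trans (count-pos i m) ≤N) λ ()
  solvable (suc N) {r} {n} mask ≤N free F a ρ trivial | yes (i , m) with pivot {free = free} {F} trivial i m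
  ... | j , fj with solvable N (mask ∖ i) (≤-pred (≤-trans (count-∖ mask m) ≤N)) free (elim F) (elimᵥ a) ρ
      (λ c supp z → pullback-zero supp (trivial (pullback c) (pullback-supp supp)
        (λ j′ f → trans (sym (·ᵣ-elim c F j′)) (z j′ f))))
    where open Elimination mask i m (λ l → F l j) (nz-elim (proj₂ (∧-true {free j} fj)))
  ... | x , x≡ρ , sol = x ⊹ at j t , agree , λ l ml → trans (eval l) (proj₂ bs l ml)
    where
    open Elimination mask i m (λ l → F l j) (nz-elim (proj₂ (∧-true {free j} fj)))
    bs = back-substitute {a} {F ·ᶜ x} (λ l ml → trans (sym (evalF-elim F x l)) (sol l ml))
    t : 𝔽
    t = proj₁ bs
    agree : ∀ j′ → free j′ ≡ false → (x ⊹ at j t) j′ ≡ ρ j′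
    agree j′ f = trans (cong₂ _+F_ (x≡ρ j′ f)
      (at-other {i = j} {j′} t λ { refl → contradiction (trans (sym f) (proj₁ (∧-true {free j} fj))) λ () })) (+F-identityʳ (ρ j′))
    eval : ∀ l → evalF (F l) (x ⊹ at j t) ≡ evalF (F l) x +F (t *F F l j)
    eval l = trans (evalF-⊹ʳ (F l) x (at j t))
      (cong (evalF (F l) x +F_) (trans (evalF-comm (F l) (at j t)) (evalF-at j t (F l))))

-- Subset sums

module SubsetSums {q : ℕ} (K : FiniteField (suc q)) where

  open FieldTheory K
  open Linear K

  embed : ∀ {n} → (Fin n → Bool) → Vecₚ n
  embed x j = bit (x j)

  ≡-pointwise : ∀ {r} {u v : Vec 𝔽 r} → (∀ l → lookup u l ≡ lookup v l) → u ≡ v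
  ≡-pointwise {u = u} {v} e = trans (sym (tabulate∘lookup u)) (trans (tabulate-cong e) (tabulate∘lookup v))

  translate : ∀ {r} → Vec 𝔽 r → Vec 𝔽 r → Vec 𝔽 r
  translate = zipWith _+F_

  lookup-iter : ∀ {r} i (v x : Vec 𝔽 r) l →
    lookup (iter i (translate v) x) l ≡ lookup x l +F fromℕ i *F lookup v l
  lookup-iter zero v x l = sym (trans
    (cong (λ z → lookup x l +F z) (trans (cong (_*F lookup v l) fromℕ-zero) (*F-zeroˡ _))) (+F-identityʳ _))
  lookup-iter (suc i) v x l = begin
    lookup (translate v (iter i (translate v) x)) l             ≡⟨ lookup-zipWith _+F_ l v _ ⟩
    lookup v l +F lookup (iter i (translate v) x) l             ≡⟨ cong (lookup v l +F_) (lookup-iter i v x l) ⟩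
    lookup v l +F (lookup x l +F fromℕ i *F lookup v l)         ≡⟨ +F-rotate (lookup v l) (lookup x l) _ ⟩
    lookup x l +F (lookup v l +F fromℕ i *F lookup v l)         ≡⟨ cong (λ z → lookup x l +F (z +F fromℕ i *F lookup v l)) (*F-identityˡ _) ⟨
    lookup x l +F (1F *F lookup v l +F fromℕ i *F lookup v l)   ≡⟨ cong (lookup x l +F_) (*F-distribʳ (lookup v l) 1F (fromℕ i)) ⟨
    lookup x l +F (1F +F fromℕ i) *F lookup v l                 ≡⟨ cong (λ z → lookup x l +F z *F lookup v l) (fromℕ-suc i) ⟨
    lookup x l +F fromℕ (suc i) *F lookup v l                   ∎
    where open ≡-Reasoning

  translate-periodic : ∀ {r} (v x : Vec 𝔽 r) → iter (suc q) (translate v) x ≡ x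
  translate-periodic v x = ≡-pointwise λ l → trans (lookup-iter (suc q) v x l) (trans
    (cong (λ z → lookup x l +F z) (trans (cong (_*F lookup v l) fromℕ-p) (*F-zeroˡ _))) (+F-identityʳ _))

  VanishesOff : ∀ {r} → (Fin r → Bool) → Vec 𝔽 r → Set
  VanishesOff mask v = ∀ l → mask l ≡ false → lookup v l ≡ 0F

  -- The whole coordinate subspace as a list, whose length bounds that of any duplicate-free list of
  -- its vectors.
  vanishing : ∀ {r} → (Fin r → Bool) → List (Vec 𝔽 r)
  vanishing {zero}  mask = [] ∷ []
  vanishing {suc r} mask = if mask fz
    then cartesianProductWith _∷_ (allFin (suc q)) (vanishing (mask ∘ fs))
    else map (0F ∷_) (vanishing (mask ∘ fs))

  length-vanishing : ∀ {r} (mask : Fin r → Bool) → length (vanishing mask) ≡ suc q ^ count mask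
  length-vanishing {zero}  mask = refl
  length-vanishing {suc r} mask with mask fz
  ... | true  = trans (length-cartesianProductWith _∷_ (allFin (suc q)) (vanishing (mask ∘ fs)))
    (cong₂ _*_ (length-tabulate (λ (i : Fin (suc q)) → i)) (length-vanishing (mask ∘ fs)))
  ... | false = trans (length-map (0F ∷_) (vanishing (mask ∘ fs))) (length-vanishing (mask ∘ fs))

  ∈-vanishing : ∀ {r} {mask : Fin r → Bool} {v} → VanishesOff mask v → v ∈ vanishing mask
  ∈-vanishing {zero}  {mask} {[]}    z = here refl
  ∈-vanishing {suc r} {mask} {a ∷ v} z with mask fz in e
  ... | true  = ∈-cartesianProductWith⁺ _∷_ (∈-allFin a) (∈-vanishing (z ∘ fs))
  ... | false rewrite z fz e = ∈-map⁺ (0F ∷_) (∈-vanishing (z ∘ fs))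

  subsetSum : ∀ {n r} → (Fin n → Vec 𝔽 r) → (Fin n → Bool) → Vecₚ r
  subsetSum col ε l = evalF (λ j → lookup (col j) l) (embed ε)

  subsetSum-∷ : ∀ {n r} (col : Fin (suc n) → Vec 𝔽 r) b ε l →
    subsetSum col (b ◂ ε) l ≡ lookup (col fz) l *F bit b +F subsetSum (col ∘ fs) ε l
  subsetSum-∷ col b ε l = ΣF-∷ _

  -- Each parameter `t` has its own subset `ε`, but all of them stay inside `J`, the columns used up
  -- by the line. `X` is the induction variable: the sums collected from the columns already
  -- processed.
  record Line {n r} (col : Fin n → Vec 𝔽 r) (nonzero : Fin n → Bool) (X : List (Vec 𝔽 r)) (m : ℕ) : Set where
    field
      J         : Fin n → Bool
      J≤m       : count J ≤ m
      J⊂nonzero : ∀ j → J j ≡ true → nonzero j ≡ true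
      dir       : Fin n
      dir-nz    : nonzero dir ≡ true
      base      : Vecₚ r
      hits      : ∀ t → ∃ λ x → ∃ λ ε → x ∈ X × (∀ j → ε j ≡ true → J j ≡ true) ×
                  (∀ l → lookup x l +F subsetSum col ε l ≡ base l +F t *F lookup (col dir) l)

  module _ {r s} {mask : Fin r → Bool} (mask≤s : count mask ≤ s) where

    -- The columns are processed in order. Either `X` contains an orbit of the translation by the
    -- current column, which is a line, or `grow X` is larger by the factor p/q and the column is
    -- put into `J`. The last hypothesis says |X| (p/q)^m > p^s, cleared of denominators, so after m
    -- growths `X` would exceed the space containing it. The bound `m ≤ count nonzero` keeps the
    -- columns from running out first.
    line : ∀ {n} (col : Fin n → Vec 𝔽 r) (nonzero : Fin n → Bool) X → Unique X →
      (∀ {x} → x ∈ X → VanishesOff mask x) → (∀ j → VanishesOff mask (col j)) →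
      ∀ m → m ≤ count nonzero → q ^ m * suc q ^ s < length X * suc q ^ m → Line col nonzero X m
    line col nonzero X u X-off col-off zero _ large = contradiction large (≤⇒≯ (begin
      length X * 1                ≡⟨ *-identityʳ (length X) ⟩
      length X                    ≤⟨ unique-⊆⇒length≤ u (∈-vanishing ∘ X-off) ⟩
      length (vanishing mask)     ≡⟨ length-vanishing mask ⟩
      suc q ^ count mask          ≤⟨ ^-monoʳ-≤ (suc q) mask≤s ⟩
      suc q ^ s                   ≡⟨ *-identityˡ (suc q ^ s) ⟨
      1 * suc q ^ s               ∎))
      where open ≤-Reasoning
    line {zero}  col nonzero X u X-off col-off (suc m) () large
    line {suc n} col nonzero X u X-off col-off (suc m) m≤ large with nonzero fz in nz₀
    -- A column outside `nonzero` is skipped, as translation by a zero column has constant orbits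
    -- and gives no proper line.
    ... | false = record
      { J = false ◂ J ; J≤m = J≤m
      ; J⊂nonzero = λ { (fs j) e → J⊂nonzero j e }
      ; dir = fs dir ; dir-nz = dir-nz ; base = base
      ; hits = λ t → let x , ε , x∈ , ε⊂ , e = hits t in x , false ◂ ε , x∈ , (λ { (fs j) e′ → ε⊂ j e′ }) ,
          λ l → trans (cong (λ z → lookup x l +F z) (skip ε l)) (e l) }
      where
      open Line (line (col ∘ fs) (nonzero ∘ fs) X u X-off (col-off ∘ fs) (suc m) m≤ large)
      skip : ∀ ε l → subsetSum col (false ◂ ε) l ≡ subsetSum (col ∘ fs) ε l
      skip ε l = trans (subsetSum-∷ col false ε l) (trans (cong (_+F subsetSum (col ∘ fs) ε l)
        (trans (cong (lookup (col fz) l *F_) bit-false) (*F-zeroʳ _))) (+F-identityˡ _))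
    ... | true with Growth.orbit-or-growth (≡-dec _≟_) q (translate (col fz)) (translate-periodic (col fz)) u
    -- The points of the line are the iterates of `x` and lie in `X` already, so `J` is empty.
    ...   | inj₁ (x , orbit) = record
      { J = λ _ → false ; J≤m = ≤-trans (≤-reflexive (count-none {suc n})) z≤n
      ; J⊂nonzero = λ _ ()
      ; dir = fz ; dir-nz = nz₀ ; base = lookup x
      ; hits = λ t → iter (toℕ t) (translate (col fz)) x , (λ _ → false) , orbit (toℕ t) (toℕ≤pred[n] t) , (λ _ ()) ,
          λ l → trans (cong₂ _+F_ (lookup-iter (toℕ t) (col fz) x l) (ΣF-zero (λ j → trans (cong (lookup (col j) l *F_) bit-false) (*F-zeroʳ _))))
            (trans (+F-identityʳ _) (cong (λ z → lookup x l +F z *F lookup (col fz) l) (fromℕ-toℕ t))) }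
    ...   | inj₂ growth = record
      { J = true ◂ J ; J≤m = s≤s J≤m
      ; J⊂nonzero = λ { fz _ → nz₀ ; (fs j) e → J⊂nonzero j e }
      ; dir = fs dir ; dir-nz = dir-nz ; base = base
      ; hits = λ t → let x , ε , x∈ , ε⊂ , e = hits t in lift t x ε x∈ ε⊂ e (∈-grow⁻ x∈) }
      where
      open Growth (≡-dec _≟_) q (translate (col fz)) (translate-periodic (col fz))
      grow-off : ∀ {x} → x ∈ grow X → VanishesOff mask x
      grow-off x∈ l m₀ with ∈-grow⁻ x∈
      ... | inj₁ x∈X = X-off x∈X l m₀
      ... | inj₂ (y , y∈X , refl) = trans (lookup-zipWith _+F_ l (col fz) y)
        (trans (cong₂ _+F_ (col-off fz l m₀) (X-off y∈X l m₀)) (+F-identityˡ 0F))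
      large′ : q ^ m * suc q ^ s < length (grow X) * suc q ^ m
      large′ = *-cancelˡ-< q _ _ (begin-strict
        q * (q ^ m * suc q ^ s)             ≡⟨ *-assoc q (q ^ m) (suc q ^ s) ⟨
        q ^ suc m * suc q ^ s               <⟨ large ⟩
        length X * (suc q * suc q ^ m)      ≡⟨ *-assoc (length X) (suc q) (suc q ^ m) ⟨
        length X * suc q * suc q ^ m        ≡⟨ cong (_* suc q ^ m) (*-comm (length X) (suc q)) ⟩
        suc q * length X * suc q ^ m        ≤⟨ *-monoˡ-≤ (suc q ^ m) growth ⟩
        q * length (grow X) * suc q ^ m     ≡⟨ *-assoc q (length (grow X)) (suc q ^ m) ⟩
        q * (length (grow X) * suc q ^ m)   ∎)
        where open ≤-Reasoning
      open Line (line (col ∘ fs) (nonzero ∘ fs) (grow X) (unique-grow u) grow-off (col-off ∘ fs) m (≤-pred m≤) large′)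
      -- An element of `grow X` that is a translate of some `y` in `X` is traded for `y`, and the
      -- first column enters the subset instead.
      lift : ∀ t x ε → x ∈ grow X → (∀ j → ε j ≡ true → J j ≡ true) →
        (∀ l → lookup x l +F subsetSum (col ∘ fs) ε l ≡ base l +F t *F lookup (col (fs dir)) l) →
        x ∈ X ⊎ (∃ λ y → y ∈ X × x ≡ translate (col fz) y) →
        ∃ λ x → ∃ λ ε → x ∈ X × (∀ j → ε j ≡ true → (true ◂ J) j ≡ true) ×
          (∀ l → lookup x l +F subsetSum col ε l ≡ base l +F t *F lookup (col (fs dir)) l)
      lift t x ε _ ε⊂ e (inj₁ x∈X) = x , false ◂ ε , x∈X , (λ { fz () ; (fs j) e′ → ε⊂ j e′ }) , λ l →
        trans (cong (λ z → lookup x l +F z) (trans (subsetSum-∷ col false ε l)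
          (trans (cong (λ z → lookup (col fz) l *F z +F subsetSum (col ∘ fs) ε l) bit-false)
            (trans (cong (_+F subsetSum (col ∘ fs) ε l) (*F-zeroʳ _)) (+F-identityˡ _))))) (e l)
      lift t x ε _ ε⊂ e (inj₂ (y , y∈X , refl)) = y , true ◂ ε , y∈X , (λ { fz _ → refl ; (fs j) e′ → ε⊂ j e′ }) , λ l → begin
        lookup y l +F subsetSum col (true ◂ ε) l                                ≡⟨ cong (lookup y l +F_) (subsetSum-∷ col true ε l) ⟩
        lookup y l +F (lookup (col fz) l *F bit true +F subsetSum (col ∘ fs) ε l) ≡⟨ cong (λ z → lookup y l +F (z +F subsetSum (col ∘ fs) ε l)) (trans (cong (lookup (col fz) l *F_) bit-true) (*F-identityʳ _)) ⟩
        lookup y l +F (lookup (col fz) l +F subsetSum (col ∘ fs) ε l)           ≡⟨ +F-assoc _ _ _ ⟨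
        lookup y l +F lookup (col fz) l +F subsetSum (col ∘ fs) ε l             ≡⟨ cong (_+F subsetSum (col ∘ fs) ε l) (trans (+F-comm _ _) (sym (lookup-zipWith _+F_ l (col fz) y))) ⟩
        lookup (translate (col fz) y) l +F subsetSum (col ∘ fs) ε l             ≡⟨ e l ⟩
        base l +F t *F lookup (col (fs dir)) l                                  ∎
        where open ≡-Reasoning

  embed-∨ : ∀ a b → (b ≡ true → a ≡ false) → bit (a ∨ b) ≡ bit a +F bit b
  embed-∨ false b     _ = sym (trans (cong (_+F bit b) bit-false) (+F-identityˡ _))
  embed-∨ true  false _ = sym (trans (cong (bit true +F_) bit-false) (+F-identityʳ _))
  embed-∨ true  true  h = contradiction (h refl) λ ()

  BooleanSolution : ∀ {r n} → (Fin r → Bool) → (Fin n → Bool) → Matrix r n → Vecₚ r → (Fin n → Bool) → Set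
  BooleanSolution mask free F a ρ = ∃ λ ρ′ → (∀ j → free j ≡ false → ρ′ j ≡ ρ j) ×
    (∀ i → mask i ≡ true → evalF (F i) (embed ρ′) ≡ a i)

  module Columns {r n} (mask : Fin r → Bool) (free : Fin n → Bool) (F : Matrix r n) where

    entry : Fin n → Vecₚ r
    entry j l = if mask l ∧ free j then F l j else 0F

    entry-on : ∀ {j l} → mask l ≡ true → free j ≡ true → entry j l ≡ F l j
    entry-on mₗ fⱼ rewrite mₗ | fⱼ = refl

    entry-off : ∀ j l → mask l ≡ false → entry j l ≡ 0F
    entry-off j l mₗ rewrite mₗ = refl

    entry-nz : ∀ {j l} → entry j l ≢ 0F → mask l ≡ true × free j ≡ true × F l j ≢ 0F
    entry-nz {j} {l} h with mask l | free j
    ... | true  | true  = refl , refl , h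
    ... | true  | false = contradiction refl h
    ... | false | _     = contradiction refl h

    col : Fin n → Vec 𝔽 r
    col j = tabulate (entry j)

    lookup-col : ∀ j l → lookup (col j) l ≡ entry j l
    lookup-col j l = lookup∘tabulate (entry j) l

    nonzero? : ∀ j → Dec (∃ λ l → entry j l ≢ 0F)
    nonzero? j = any? (λ l → ¬? (entry j l ≟ 0F))

    nonzero : Fin n → Bool
    nonzero j = does (nonzero? j)

    nonzero-intro : ∀ {j} l → entry j l ≢ 0F → nonzero j ≡ true
    nonzero-intro {j} l h with nonzero? j
    ... | yes _ = refl
    ... | no ¬e = contradiction (l , h) ¬e

    nonzero-elim : ∀ {j} → nonzero j ≡ true → ∃ λ l → entry j l ≢ 0F
    nonzero-elim {j} e with nonzero? j
    ... | yes h = h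

    -- Already the single row `i₀` has weight at least `m` on `free`, and each coordinate counted
    -- there belongs to a nonzero column.
    count-nonzero : ∀ {i₀ m} → mask i₀ ≡ true →
      (∀ c → Supp mask c → wt free (c ·ᵣ F) < m → IsZeroVec c) → m ≤ count nonzero
    count-nonzero {i₀} {m} m₀ dist = begin
      m                              ≤⟨ ≮⇒≥ (λ small → 0F≢1F (trans (sym (dist (at i₀ 1F) (at-supp 1F m₀) small i₀)) (at-self i₀ 1F))) ⟩
      wt free (at i₀ 1F ·ᵣ F)        ≤⟨ count-mono column ⟩
      count nonzero                  ∎
      where
      open ≤-Reasoning
      column : ∀ j → free j ∧ nz ((at i₀ 1F ·ᵣ F) j) ≡ true → nonzero j ≡ true
      column j e = let fⱼ , v≢0 = ∧-true {free j} e in nonzero-intro i₀ λ z → nz-elim v≢0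
        (trans (evalF-at i₀ 1F (λ l → F l j)) (trans (*F-identityˡ (F i₀ j)) (trans (sym (entry-on m₀ fⱼ)) z)))

    module Quotient (J : Fin n → Bool) (J⊂nonzero : ∀ j → J j ≡ true → nonzero j ≡ true)
      (dir : Fin n) (free-dir : free dir ≡ true) (i : Fin r) (mask-i : mask i ≡ true)
      (nz-i : F i dir ≢ 0F) where

      open Elimination mask i mask-i (λ l → F l dir) nz-i public

      J⊂free : ∀ {j} → J j ≡ true → free j ≡ true
      J⊂free {j} e = proj₁ (proj₂ (entry-nz (proj₂ (nonzero-elim (J⊂nonzero j e)))))

      unused : Fin n → Bool
      unused j = free j ∧ not (J j)

      -- The coordinates of `J` are set to false, so that a subset of `J` can be added later by a
      -- disjunction.
      clear : (Fin n → Bool) → Fin n → Bool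
      clear ρ j = ρ j ∧ not (J j)

      -- A combination of the eliminated rows is one of the original rows, and only the coordinates
      -- of `J` are lost, so the quotient costs at most `m` in distance.
      dist-elim : ∀ {m N} → count J ≤ m →
        (∀ c → Supp mask c → wt free (c ·ᵣ F) < m + N → IsZeroVec c) →
        ∀ c → Supp (mask ∖ i) c → wt unused (c ·ᵣ elim F) < N → IsZeroVec c
      dist-elim J≤m dist c supp small = pullback-zero supp (dist (pullback c) (pullback-supp supp)
        (≤-<-trans (count-cover {Q = J} split) (+-mono-≤-< J≤m small)))
        where
        split : ∀ j → free j ∧ nz ((pullback c ·ᵣ F) j) ≡ true →
          J j ≡ true ⊎ unused j ∧ nz ((c ·ᵣ elim F) j) ≡ true
        split j e with ∧-true {free j} e | J j
        ... | _        | true  = inj₁ refl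
        ... | fⱼ , nzⱼ | false = inj₂ (∧-intro (∧-intro fⱼ refl) (trans (cong nz (·ᵣ-elim c F j)) nzⱼ))

      -- The assignment `y` solves the system for `a - base` up to the multiple `t` of the
      -- direction, and the subset `ε` contributes exactly `base` plus that multiple. Since `y` is
      -- false on `J`, the two Boolean vectors add up to their disjunction.
      combine : {a base : Vecₚ r} {t : 𝔽} {ρ y ε : Fin n → Bool} → (∀ j → unused j ≡ false → y j ≡ clear ρ j) →
        (∀ l → mask l ≡ true → (F ·ᶜ embed y) l +F t *F F l dir ≡ a l +F -F base l) →
        (∀ j → ε j ≡ true → J j ≡ true) → (∀ l → subsetSum col ε l ≡ base l +F t *F entry dir l) →
        BooleanSolution mask free F a ρ
      combine {a} {base} {t} {ρ} {y} {ε} y≡ y-eq ε⊂J ε-hits = (λ j → y j ∨ ε j) , agree , solves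
        where
        open ≡-Reasoning
        agree : ∀ j → free j ≡ false → y j ∨ ε j ≡ ρ j
        agree j fⱼ = begin
          y j ∨ ε j          ≡⟨ cong (y j ∨_) (not-true λ e → contradiction (trans (sym fⱼ) (J⊂free (ε⊂J j e))) λ ()) ⟩
          y j ∨ false        ≡⟨ Bool.∨-identityʳ (y j) ⟩
          y j                ≡⟨ y≡ j (cong (_∧ not (J j)) fⱼ) ⟩
          ρ j ∧ not (J j)    ≡⟨ cong (λ b → ρ j ∧ not b) (not-true λ e → contradiction (trans (sym fⱼ) (J⊂free e)) λ ()) ⟩
          ρ j ∧ true         ≡⟨ Bool.∧-identityʳ (ρ j) ⟩
          ρ j                ∎
        disjoint : ∀ j → ε j ≡ true → y j ≡ false
        disjoint j e = trans (y≡ j (trans (cong (λ b → free j ∧ not b) (ε⊂J j e)) (Bool.∧-zeroʳ (free j))))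
          (trans (cong (λ b → ρ j ∧ not b) (ε⊂J j e)) (Bool.∧-zeroʳ (ρ j)))
        term : ∀ l → mask l ≡ true → ∀ j → F l j *F bit (ε j) ≡ lookup (col j) l *F bit (ε j)
        term l mₗ j with ε j in e
        ... | true  = cong (_*F bit true) (sym (trans (lookup-col j l) (entry-on mₗ (J⊂free (ε⊂J j e)))))
        ... | false = trans (trans (cong (F l j *F_) bit-false) (*F-zeroʳ _))
          (sym (trans (cong (lookup (col j) l *F_) bit-false) (*F-zeroʳ _)))
        solves : ∀ l → mask l ≡ true → evalF (F l) (embed λ j → y j ∨ ε j) ≡ a l
        solves l mₗ = begin
          evalF (F l) (embed λ j → y j ∨ ε j)                           ≡⟨ evalF-cong (λ _ → refl) (λ j → embed-∨ (y j) (ε j) (disjoint j)) ⟩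
          evalF (F l) (embed y ⊹ embed ε)                               ≡⟨ evalF-⊹ʳ (F l) (embed y) (embed ε) ⟩
          evalF (F l) (embed y) +F evalF (F l) (embed ε)                ≡⟨ cong (evalF (F l) (embed y) +F_) (trans (ΣF-cong (term l mₗ)) (ε-hits l)) ⟩
          evalF (F l) (embed y) +F (base l +F t *F entry dir l)         ≡⟨ cong (λ z → evalF (F l) (embed y) +F (base l +F t *F z)) (entry-on mₗ free-dir) ⟩
          evalF (F l) (embed y) +F (base l +F t *F F l dir)             ≡⟨ +F-rotate _ (base l) (t *F F l dir) ⟩
          base l +F (evalF (F l) (embed y) +F t *F F l dir)             ≡⟨ cong (base l +F_) (y-eq l mₗ) ⟩
          base l +F (a l +F -F base l)                                  ≡⟨ trans (+F-comm (base l) _) (+F-solve (a l) (base l)) ⟩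
          a l                                                           ∎

  module _ (s m : ℕ) (expanding : q ^ m * suc q ^ s < suc q ^ m) where

    -- Some subset sums of at most m columns fill a line in direction w. Modulo w one row is
    -- eliminated, and the remaining columns solve the smaller system.
    boolean-onto : ∀ N → N ≤ s → ∀ {r n} (mask : Fin r → Bool) → count mask ≤ N →
      (free : Fin n → Bool) (F : Matrix r n) (a : Vecₚ r) (ρ : Fin n → Bool) →
      (∀ c → Supp mask c → wt free (c ·ᵣ F) < N * m → IsZeroVec c) → BooleanSolution mask free F a ρ

    boolean-onto-line : ∀ N → N < s → ∀ {r n} (mask : Fin r → Bool) → count mask ≤ suc N →
      (free : Fin n → Bool) (F : Matrix r n) (a : Vecₚ r) (ρ : Fin n → Bool) →
      (∀ c → Supp mask c → wt free (c ·ᵣ F) < suc N * m → IsZeroVec c) → let open Columns mask free F in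
      Line col nonzero (replicate r 0F ∷ []) m → BooleanSolution mask free F a ρ

    boolean-onto N N≤s mask mask≤N free F a ρ dist with any? (λ i → mask i Bool.≟ true)
    ... | no none = ρ , (λ _ _ → refl) , λ i mᵢ → contradiction (i , mᵢ) none
    boolean-onto zero N≤s mask mask≤N free F a ρ dist | yes (i , mᵢ) =
      contradiction (≤-trans (count-pos i mᵢ) mask≤N) λ ()
    boolean-onto (suc N) N<s {r} mask mask≤N free F a ρ dist | yes (i₀ , m₀) =
      boolean-onto-line N N<s mask mask≤N free F a ρ dist
        (line {mask = mask} (≤-trans mask≤N N<s) col nonzero (replicate r 0F ∷ []) ([] ∷ [])
          (λ { (here refl) l _ → lookup-replicate l 0F })
          (λ j l mₗ → trans (lookup-col j l) (entry-off j l mₗ))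
          m (count-nonzero m₀ λ c supp small → dist c supp (<-≤-trans small (m≤m+n m (N * m))))
          -- At the start `X` consists of the zero vector, so the size condition with length 1 is
          -- `expanding`.
          (<-≤-trans expanding (≤-reflexive (sym (*-identityˡ (suc q ^ m))))))
      where open Columns mask free F

    boolean-onto-line N N<s mask mask≤N free F a ρ dist
      record { J = J ; J≤m = J≤m ; J⊂nonzero = J⊂nonzero ; dir = dir ; dir-nz = dir-nz ; base = base ; hits = hits }
      with Columns.nonzero-elim mask free F dir-nz
    ... | i , entry≢0 with Columns.entry-nz mask free F entry≢0
    ...   | mask-i , free-dir , nz-i with boolean-onto N (<⇒≤ N<s) (mask ∖ i)
        (≤-pred (≤-trans (count-∖ mask mask-i) mask≤N)) unused (elim F) (elimᵥ λ l → a l +F -F base l) (clear ρ)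
        (dist-elim J≤m dist)
      where open Columns.Quotient mask free F J J⊂nonzero dir free-dir i mask-i nz-i
    ...     | y , y≡ , y-solves with back-substitute (λ l mₗ → trans (sym (evalF-elim F (embed y) l)) (y-solves l mₗ))
      where open Columns.Quotient mask free F J J⊂nonzero dir free-dir i mask-i nz-i
    -- The multiple `t` is known only once the quotient system has been solved. Every point of the
    -- line is a subset sum, so whichever `t` results can be supplied.
    ...       | t , t-solves with hits t
    ...         | _ , ε , here refl , ε⊂J , ε-hits = Columns.Quotient.combine mask free F
      J J⊂nonzero dir free-dir i mask-i nz-i y≡ t-solves ε⊂J
      (λ l → trans (sym (trans (cong (_+F subsetSum (Columns.col mask free F) ε l) (lookup-replicate l 0F)) (+F-identityˡ _)))
        (trans (ε-hits l) (cong (λ z → base l +F t *F z) (Columns.lookup-col mask free F dir l))))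

-- Positions of the game

infixl 8 _[_≔_]

_[_≔_] : ∀ {A : Set} {n} → (Fin n → A) → Fin n → A → Fin n → A
(v [ i ≔ a ]) l = if does (i ≟ l) then a else v l

≔-self : ∀ {A : Set} {n} (v : Fin n → A) i a → (v [ i ≔ a ]) i ≡ a
≔-self v i a with i ≟ i
... | yes _  = refl
... | no i≢i = contradiction refl i≢i

≔-other : ∀ {A : Set} {n} (v : Fin n → A) {i l} a → i ≢ l → (v [ i ≔ a ]) l ≡ v l
≔-other v {i} {l} a i≢l with i ≟ l
... | yes i≡l = contradiction i≡l i≢l
... | no _    = refl

true≢false : ∀ {b} → b ≡ true → b ≢ false
true≢false refl ()

-- Trading a row for a linear combination.

module Replacement {p : ℕ} (K : FiniteField p) where

  open FieldTheory K
  open Linear K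

  ΣF-split : ∀ {n} (v : Vecₚ n) i → ΣF v ≡ v i +F ΣF (v [ i ≔ 0F ])
  ΣF-split v i = trans (ΣF-cong pointwise) (trans (ΣF-+ (at i (v i)) (v [ i ≔ 0F ]))
    (cong (_+F ΣF (v [ i ≔ 0F ])) (trans (ΣF-single i (λ j → at-other (v i))) (at-self i (v i)))))
    where
    pointwise : ∀ l → v l ≡ at i (v i) l +F (v [ i ≔ 0F ]) l
    pointwise l with i ≟ l
    ... | yes refl = sym (+F-identityʳ (v l))
    ... | no _     = sym (+F-identityˡ (v l))

  *F-cancelˡ : ∀ {a b c} → a ≢ 0F → a *F b ≡ a *F c → b ≡ c
  *F-cancelˡ {a} {b} {c} a≢0 e with inverse a≢0
  ... | v , va = trans (sym (collapse b)) (trans (cong (v *F_) e) (collapse c))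
    where
    collapse : ∀ z → v *F (a *F z) ≡ z
    collapse z = trans (sym (*F-assoc v a z)) (trans (cong (_*F z) va) (*F-identityˡ z))

  -- Cancelling the agreeing terms leaves the summand at `i`. This recovers a traded row from the
  -- combination and the remaining rows.
  evalF-determines : ∀ {r} {c u v : Vecₚ r} {i} → c i ≢ 0F → (∀ l → i ≢ l → c l *F u l ≡ c l *F v l) →
    evalF c u ≡ evalF c v → u i ≡ v i
  evalF-determines {c = c} {u} {v} {i} cᵢ≢0 others e = *F-cancelˡ cᵢ≢0 (+F-cancelˡ (rest u) (begin
    rest u +F c i *F u i      ≡⟨ +F-comm _ _ ⟩
    c i *F u i +F rest u      ≡⟨ ΣF-split (λ l → c l *F u l) i ⟨
    evalF c u                 ≡⟨ e ⟩
    evalF c v                 ≡⟨ ΣF-split (λ l → c l *F v l) i ⟩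
    c i *F v i +F rest v      ≡⟨ cong (c i *F v i +F_) (ΣF-cong same) ⟨
    c i *F v i +F rest u      ≡⟨ +F-comm _ _ ⟩
    rest u +F c i *F v i      ∎))
    where
    open ≡-Reasoning
    rest : Vecₚ _ → 𝔽
    rest z = ΣF ((λ l → c l *F z l) [ i ≔ 0F ])
    same : ∀ l → ((λ l → c l *F u l) [ i ≔ 0F ]) l ≡ ((λ l → c l *F v l) [ i ≔ 0F ]) l
    same l with i ≟ l
    ... | yes _  = refl
    ... | no i≢l = others l i≢l

  -- Coefficients with respect to the original rows of a combination `c′` of the system whose row
  -- `i` has been replaced by the combination `c`.
  substitute : ∀ {r} → Vecₚ r → Fin r → Vecₚ r → Vecₚ r
  substitute c i c′ = c′ [ i ≔ 0F ] ⊹ c′ i ✶ c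

  ·ᵣ-replace : ∀ {r n} (F : Matrix r n) i c c′ j →
    (c′ ·ᵣ (F [ i ≔ c ·ᵣ F ])) j ≡ (substitute c i c′ ·ᵣ F) j
  ·ᵣ-replace F i c c′ j = begin
    ΣF (λ l → c′ l *F (F [ i ≔ c ·ᵣ F ]) l j)                             ≡⟨ ΣF-cong pointwise ⟩
    ΣF (λ l → (c′ [ i ≔ 0F ]) l *F F l j +F at i (c′ i) l *F (c ·ᵣ F) j)  ≡⟨ ΣF-+ _ _ ⟩
    (c′ [ i ≔ 0F ] ·ᵣ F) j +F evalF (at i (c′ i)) (λ _ → (c ·ᵣ F) j)      ≡⟨ cong ((c′ [ i ≔ 0F ] ·ᵣ F) j +F_) (evalF-at i (c′ i) _) ⟩
    (c′ [ i ≔ 0F ] ·ᵣ F) j +F c′ i *F (c ·ᵣ F) j                          ≡⟨ cong ((c′ [ i ≔ 0F ] ·ᵣ F) j +F_) (evalF-✶ˡ (c′ i) c _) ⟨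
    (c′ [ i ≔ 0F ] ·ᵣ F) j +F (c′ i ✶ c ·ᵣ F) j                           ≡⟨ evalF-⊹ˡ (c′ [ i ≔ 0F ]) (c′ i ✶ c) _ ⟨
    (substitute c i c′ ·ᵣ F) j                                            ∎
    where
    open ≡-Reasoning
    pointwise : ∀ l → c′ l *F (F [ i ≔ c ·ᵣ F ]) l j ≡ (c′ [ i ≔ 0F ]) l *F F l j +F at i (c′ i) l *F (c ·ᵣ F) j
    pointwise l with i ≟ l
    ... | yes refl = sym (trans (cong (_+F c′ i *F (c ·ᵣ F) j) (*F-zeroˡ _)) (+F-identityˡ _))
    ... | no _     = sym (trans (cong (c′ l *F F l j +F_) (*F-zeroˡ _)) (+F-identityʳ _))

  -- Entry `i` of the substitution is `c′ i *F c i`, which forces `c′ i` to be zero; the other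
  -- entries are then those of `c′`.
  substitute-zero : ∀ {r} {c : Vecₚ r} {i c′} → c i ≢ 0F → IsZeroVec (substitute c i c′) → IsZeroVec c′
  substitute-zero {c = c} {i} {c′} cᵢ≢0 z = zeros
    where
    c′ᵢ≡0 : c′ i ≡ 0F
    c′ᵢ≡0 = *F-cancelʳ-0 cᵢ≢0 (trans (sym (+F-identityˡ _)) (trans (cong (_+F c′ i *F c i) (sym (≔-self c′ i 0F))) (z i)))
    zeros : IsZeroVec c′
    zeros l with i ≟ l
    ... | yes refl = c′ᵢ≡0
    ... | no i≢l = trans (sym (+F-identityʳ (c′ l))) (trans
      (cong₂ _+F_ (sym (≔-other c′ 0F i≢l)) (sym (trans (cong (_*F c l) c′ᵢ≡0) (*F-zeroˡ _)))) (z l))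

  substitute-supp : ∀ {r} {mask : Fin r → Bool} {c i c′} → Supp mask c → Supp mask c′ → Supp mask (substitute c i c′)
  substitute-supp {c = c} {i} {c′} supp supp′ l m with i ≟ l
  ... | yes _ = trans (+F-identityˡ _) (trans (cong (c′ i *F_) (supp l m)) (*F-zeroʳ _))
  ... | no _  = trans (cong₂ _+F_ (supp′ l m) (trans (cong (c′ i *F_) (supp l m)) (*F-zeroʳ _))) (+F-identityˡ _)

  substitute-fixed : ∀ {r} {c : Vecₚ r} {i c′} → c′ i ≡ 0F → ∀ l → substitute c i c′ l ≡ c′ l
  substitute-fixed {c = c} {i} {c′} z l = trans (cong₂ _+F_ keep (trans (cong (_*F c l) z) (*F-zeroˡ _))) (+F-identityʳ _)
    where
    keep : (c′ [ i ≔ 0F ]) l ≡ c′ l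
    keep with i ≟ l
    ... | yes refl = sym z
    ... | no _     = refl

  supp? : ∀ {r} (mask : Fin r → Bool) c → Dec (Supp mask c)
  supp? mask c = all? λ i → (mask i Bool.≟ false) →-dec (c i ≟ 0F)

  zero? : ∀ {n} (v : Vecₚ n) → Dec (IsZeroVec v)
  zero? v = all? λ j → v j ≟ 0F

  wt-cong : ∀ {n} {free : Fin n → Bool} {u v : Vecₚ n} → (∀ j → u j ≡ v j) → wt free u ≤ wt free v
  wt-cong {free = free} {v = v} e = wt-mono {free = free} {v = v} λ j _ z → trans (e j) z

  ·ᵣ-congˡ : ∀ {r n} {c c′ : Vecₚ r} (F : Matrix r n) → (∀ i → c i ≡ c′ i) → ∀ j → (c ·ᵣ F) j ≡ (c′ ·ᵣ F) j
  ·ᵣ-congˡ F e j = evalF-cong e λ _ → refl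

  ·ᵣ-∷ : ∀ {r n} (c : Vecₚ (suc r)) f (F : Matrix r n) j → (c ·ᵣ (f ◂ F)) j ≡ c fz *F f j +F ((c ∘ fs) ·ᵣ F) j
  ·ᵣ-∷ c f F j = ΣF-∷ _

-- Positions with a budget, and restoring their distance.

module Positions {q : ℕ} (K : FiniteField (suc q)) (n d M m : ℕ)
  (expanding : q ^ m * suc q ^ M < suc q ^ m) (D>0 : 1 ≤ M * m)
  (d-large : (M * m + M * m) * M + (M * m + M * m) ≤ d) where

  open FieldTheory K
  open Linear K
  open SubsetSums K
  open Replacement K

  -- `D` is the distance that `boolean-onto` asks of `M` rows. With `T` twice as large, distance `D`
  -- survives the loss of fewer than `D` coordinates.
  D T : ℕ
  D = M * m
  T = D + D

  D≤T : D ≤ T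
  D≤T = m≤m+n D D

  _∖∖_ : ∀ {r} → (Fin r → Bool) → (Fin r → Bool) → Fin r → Bool
  (P ∖∖ Q) i = P i ∧ not (Q i)

  fixed : (Fin n → Bool) → Fin n → Bool
  fixed free j = not (free j)

  everywhere : Fin n → Bool
  everywhere _ = true

  -- With g branching points to go, each active row outside base, like each of these branching points,
  -- is worth T fixed coordinates.
  record Position (g : ℕ) (G : Vecₚ n → Set) : Set where
    constructor position
    field
      {r}       : ℕ
      F         : Matrix r n
      a         : Vecₚ r
      base act  : Fin r → Bool
      free ρ    : Fin n → Bool
      base⊂act  : ∀ i → base i ≡ true → act i ≡ true
      base-dist : ∀ c → Supp base c → wt everywhere (c ·ᵣ F) < d → IsZeroVec c
      act-dist  : ∀ c → Supp act c → wt free (c ·ᵣ F) < T → IsZeroVec c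
      budget    : count (fixed free) + T * (count (act ∖∖ base) + g) ≤ T * M
      implies   : ∀ x → (∀ j → free j ≡ false → x j ≡ embed ρ j) →
                  (∀ i → act i ≡ true → evalF (F i) x ≡ a i) → G x

  -- A position whose distance has dropped below T on the coordinates free₀. The rows of tot outside
  -- act live on coordinates that have left free; ρ remains to be chosen there so as to satisfy them.
  record Pending (g : ℕ) (G : Vecₚ n → Set) : Set where
    constructor pending
    field
      {r}        : ℕ
      F          : Matrix r n
      a          : Vecₚ r
      base act tot : Fin r → Bool
      free free₀ ρ : Fin n → Bool
      base⊂act   : ∀ i → base i ≡ true → act i ≡ true
      act⊂tot    : ∀ i → act i ≡ true → tot i ≡ true
      free⊂free₀ : ∀ j → free j ≡ true → free₀ j ≡ true
      base-dist  : ∀ c → Supp base c → wt everywhere (c ·ᵣ F) < d → IsZeroVec c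
      tot-dist   : ∀ c → Supp tot c → wt free₀ (c ·ᵣ F) < D → IsZeroVec c
      dropped    : ∀ i → tot i ≡ true → act i ≡ false → ∀ j → free j ≡ true → F i j ≡ 0F
      budget     : count (fixed free) + T * (count (act ∖∖ base) + g) ≤ T * M
      tot≤M      : count (tot ∖∖ base) ≤ M
      implies    : ∀ x → (∀ j → free₀ j ≡ false → x j ≡ embed ρ j) →
                   (∀ i → tot i ≡ true → evalF (F i) x ≡ a i) → G x

  ⊂-false : ∀ {r} {P Q : Fin r → Bool} → (∀ i → P i ≡ true → Q i ≡ true) → ∀ i → Q i ≡ false → P i ≡ false
  ⊂-false h i e = not-true λ e′ → true≢false (h i e′) e

  ∖∖-intro : ∀ {a b} → a ≡ true → b ≡ false → a ∧ not b ≡ true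
  ∖∖-intro refl refl = refl

  ∖∖-elim : ∀ {a b} → a ∧ not b ≡ true → a ≡ true × b ≡ false
  ∖∖-elim {true} {false} _ = refl , refl

  module _ {g G} (P : Pending g G) where
    open Pending P

    -- The dropped rows are at most `M` and have distance `D` on `free₀`, so `boolean-onto`
    -- satisfies them by a new choice of `ρ`. That choice also assigns the coordinates of `free`,
    -- but the dropped rows vanish there, so these values need not be kept.
    finish : (∀ c → Supp act c → wt free (c ·ᵣ F) < T → IsZeroVec c) → Position g G
    finish act-dist with boolean-onto M m expanding M ≤-refl (tot ∖∖ act) few free₀ F a ρ
        (λ c supp → tot-dist c λ i e → supp i (cong (_∧ not (act i)) e))
      where
      few : count (tot ∖∖ act) ≤ M
      few = ≤-trans (count-mono λ i e → let t , ¬act = ∖∖-elim {tot i} e in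
        ∖∖-intro t (⊂-false {P = base} base⊂act i ¬act)) tot≤M
    ... | ρ′ , ρ′≡ρ , solves = position F a base act free ρ′ base⊂act base-dist act-dist budget
      λ x x≡ρ′ sat → implies x
        (λ j e → trans (x≡ρ′ j (⊂-false {P = free} free⊂free₀ j e)) (cong bit (ρ′≡ρ j e)))
        (rows x x≡ρ′ sat)
      where
      rows : ∀ x → (∀ j → free j ≡ false → x j ≡ embed ρ′ j) → (∀ i → act i ≡ true → evalF (F i) x ≡ a i) →
        ∀ i → tot i ≡ true → evalF (F i) x ≡ a i
      rows x x≡ρ′ sat i t with act i in e
      ... | true  = sat i e
      ... | false = trans (ΣF-cong term) (solves i (∖∖-intro t e))
        where
        term : ∀ j → F i j *F x j ≡ F i j *F embed ρ′ j
        term j with free j in f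
        ... | false = cong (F i j *F_) (x≡ρ′ j f)
        ... | true  = trans (cong (_*F x j) (dropped i t e j f))
          (trans (*F-zeroˡ _) (sym (trans (cong (_*F embed ρ′ j) (dropped i t e j f)) (*F-zeroˡ _))))

    Short : Vecₚ r → Set
    Short c = Supp act c × wt free (c ·ᵣ F) < T × ¬ IsZeroVec c

    short? : Dec (∃ Short)
    short? = search
      (λ e (supp , small , c≢0) → (λ i m → trans (sym (e i)) (supp i m)) ,
        ≤-<-trans (wt-cong (·ᵣ-congˡ F (sym ∘ e))) small , λ z → c≢0 λ i → trans (e i) (z i))
      (λ c → supp? act c ×-dec (wt free (c ·ᵣ F) <? T) ×-dec ¬? (zero? c))

    -- A combination of rows of `base` alone gains at most the fixed coordinates outside `free`, at
    -- most `T * M` by the budget. Its total weight would be below `T * M + T`, hence below `d`.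
    short-active : ∀ {c} → Short c → ∃ λ i → act i ≡ true × base i ≡ false × c i ≢ 0F
    short-active {c} (supp , small , c≢0) with any? (λ i → (base i Bool.≟ false) ×-dec ¬? (c i ≟ 0F))
    ... | yes (i , b , cᵢ≢0) = i , not-false (λ e → cᵢ≢0 (supp i e)) , b , cᵢ≢0
    ... | no none = contradiction (base-dist c supp-base (begin-strict
        wt everywhere (c ·ᵣ F)                       ≤⟨ count-cover {Q = fixed free} split ⟩
        count (fixed free) + wt free (c ·ᵣ F)        <⟨ +-mono-≤-< (m+n≤o⇒m≤o (count (fixed free)) budget) small ⟩
        T * M + T                                    ≤⟨ d-large ⟩
        d                                            ∎)) c≢0
      where
      open ≤-Reasoning
      supp-base : Supp base c
      supp-base i b with c i ≟ 0F
      ... | yes z   = z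
      ... | no cᵢ≢0 = contradiction (i , b , cᵢ≢0) none
      split : ∀ j → nz ((c ·ᵣ F) j) ≡ true → fixed free j ≡ true ⊎ free j ∧ nz ((c ·ᵣ F) j) ≡ true
      split j e with free j
      ... | true  = inj₂ e
      ... | false = inj₁ refl

    -- Row i is traded for the short combination c ·ᵣ F, which becomes supported off free.
    module _ {c} (short : Short c) {i} (actᵢ : act i ≡ true) (baseᵢ : base i ≡ false) (cᵢ≢0 : c i ≢ 0F) where

      private
        F′ : Matrix r n
        F′ = F [ i ≔ c ·ᵣ F ]

        free′ : Fin n → Bool
        free′ j = free j ∧ not (nz ((c ·ᵣ F) j))

        supp-tot : Supp tot c
        supp-tot l e = proj₁ short l (⊂-false {P = act} act⊂tot l e)

      fewer-active : suc (count ((act ∖ i) ∖∖ base)) ≤ count (act ∖∖ base)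
      fewer-active = ≤-trans (s≤s (count-mono λ l e → let al , bl = ∖∖-elim {(act ∖ i) l} e
                                                          al′ , i≢l = ∖-true act {i} {l} al in
          trans (∖-other (act ∖∖ base) i≢l) (∖∖-intro al′ bl)))
        (count-∖ (act ∖∖ base) (∖∖-intro actᵢ baseᵢ))

      drop : Pending g G
      drop = pending F′ (a [ i ≔ evalF c a ]) base (act ∖ i) tot free′ free₀ ρ
        (λ l b → trans (∖-other act {i} {l} λ { refl → true≢false b baseᵢ }) (base⊂act l b))
        (λ l e → act⊂tot l (proj₁ (∖-true act {i} {l} e)))
        (λ j e → free⊂free₀ j (proj₁ (∧-true {free j} e)))
        -- Row `i` is not in `base`, so a combination of `base` rows has coefficient zero there and
        -- does not see the trade.
        (λ c′ supp small → base-dist c′ supp (≤-<-trans (wt-cong {free = everywhere} λ j →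
          sym (trans (·ᵣ-replace F i c c′ j) (·ᵣ-congˡ F (substitute-fixed {c = c} (supp i baseᵢ)) j))) small))
        (λ c′ supp small → substitute-zero cᵢ≢0 (tot-dist (substitute c i c′) (substitute-supp {c = c} supp-tot supp)
          (≤-<-trans (wt-cong {free = free₀} λ j → sym (·ᵣ-replace F i c c′ j)) small)))
        vanish
        -- Fewer than `T` coordinates become fixed, and they are paid for by row `i`, which is no
        -- longer active.
        (begin
          count (fixed free′) + T * (count ((act ∖ i) ∖∖ base) + g)        ≤⟨ +-monoˡ-≤ _ fixed≤ ⟩
          count (fixed free) + T + T * (count ((act ∖ i) ∖∖ base) + g)     ≡⟨ +-assoc (count (fixed free)) T _ ⟩
          count (fixed free) + (T + T * (count ((act ∖ i) ∖∖ base) + g))   ≡⟨ cong (count (fixed free) +_) (*-suc T _) ⟨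
          count (fixed free) + T * suc (count ((act ∖ i) ∖∖ base) + g)     ≤⟨ +-monoʳ-≤ (count (fixed free)) (*-monoʳ-≤ T (+-monoˡ-≤ g fewer-active)) ⟩
          count (fixed free) + T * (count (act ∖∖ base) + g)               ≤⟨ budget ⟩
          T * M                                                            ∎)
        tot≤M
        (λ x x≡ρ sat → implies x x≡ρ (rows x sat))
        where
        open ≤-Reasoning
        fixed≤ : count (fixed free′) ≤ count (fixed free) + T
        fixed≤ = ≤-trans (count-cover {Q = fixed free} {R = λ j → free j ∧ nz ((c ·ᵣ F) j)} split)
          (+-monoʳ-≤ (count (fixed free)) (<⇒≤ (proj₁ (proj₂ short))))
          where
          split : ∀ j → fixed free′ j ≡ true → fixed free j ≡ true ⊎ free j ∧ nz ((c ·ᵣ F) j) ≡ true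
          split j e with free j | nz ((c ·ᵣ F) j)
          ... | false | _    = inj₁ refl
          ... | true  | true = inj₂ refl
        vanish : ∀ l → tot l ≡ true → (act ∖ i) l ≡ false → ∀ j → free′ j ≡ true → F′ l j ≡ 0F
        vanish l t e j f with i ≟ l | ∖∖-elim {free j} f
        ... | yes refl | fⱼ , z = ¬nz z
        ... | no i≢l   | fⱼ , z = dropped l t (trans (sym (Bool.∧-identityʳ (act l))) e) j fⱼ
        other : ∀ x → (∀ l → tot l ≡ true → evalF (F′ l) x ≡ (a [ i ≔ evalF c a ]) l) →
          ∀ l → i ≢ l → tot l ≡ true → evalF (F l) x ≡ a l
        other x sat l i≢l t = trans (cong (λ u → evalF u x) (sym (≔-other F (c ·ᵣ F) i≢l)))
          (trans (sat l t) (≔-other a (evalF c a) i≢l))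
        rows : ∀ x → (∀ l → tot l ≡ true → evalF (F′ l) x ≡ (a [ i ≔ evalF c a ]) l) →
          ∀ l → tot l ≡ true → evalF (F l) x ≡ a l
        rows x sat l t with i ≟ l
        ... | no i≢l   = other x sat l i≢l t
        ... | yes refl = evalF-determines {c = c} {F ·ᶜ x} {a} {i} cᵢ≢0 others
          (trans (sym (evalF-·ᵣ c F x)) (trans (cong (λ u → evalF u x) (sym (≔-self F i (c ·ᵣ F))))
            (trans (sat i t) (≔-self a i (evalF c a)))))
          where
          others : ∀ l → i ≢ l → c l *F (F ·ᶜ x) l ≡ c l *F a l
          others l i≢l with tot l in e
          ... | true  = cong (c l *F_) (other x sat l i≢l e)
          ... | false = trans (cong (_*F (F ·ᶜ x) l) (supp-tot l e))
            (trans (*F-zeroˡ _) (sym (trans (cong (_*F a l) (supp-tot l e)) (*F-zeroˡ _))))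

  -- Each `drop` removes an active row outside `base`, so the search for short combinations must
  -- end, and then `finish` applies.
  restore : ∀ N {g G} (P : Pending g G) → count (Pending.act P ∖∖ Pending.base P) ≤ N → Position g G
  restore N P small with short? P
  ... | no none = finish P λ c supp wt< → all-zero c λ c≢0 → none (c , supp , wt< , c≢0)
    where
    all-zero : ∀ {r} (c : Vecₚ r) → ¬ ¬ IsZeroVec c → IsZeroVec c
    all-zero c h with zero? c
    ... | yes z = z
    ... | no ¬z = contradiction ¬z h
  ... | yes (c , short) with short-active P short
  ...   | i , actᵢ , baseᵢ , cᵢ≢0 with N
  ...     | zero   = contradiction (≤-trans (fewer-active P short actᵢ baseᵢ cᵢ≢0) small) λ ()
  ...     | suc N′ = restore N′ (drop P short actᵢ baseᵢ cᵢ≢0)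
    (≤-pred (≤-trans (fewer-active P short actᵢ baseᵢ cᵢ≢0) small))

  -- Answers to Prover's forms.

  With : (Vecₚ n → Set) → Vecₚ n → 𝔽 → Vecₚ n → Set
  With G f v x = G x × evalF f x ≡ v

  T>0 : 1 ≤ T
  T>0 = ≤-trans D>0 D≤T

  M>0 : 1 ≤ M
  M>0 = n≢0⇒n>0 λ e → contradiction (subst (1 ≤_) (cong (_* m) e) D>0) λ ()

  evalF-agree : ∀ {f x y : Vecₚ n} → (∀ j → f j ≢ 0F → x j ≡ y j) → evalF f x ≡ evalF f y
  evalF-agree {f} {x} {y} h = ΣF-cong term
    where
    term : ∀ j → f j *F x j ≡ f j *F y j
    term j with f j ≟ 0F
    ... | no fⱼ≢0 = cong (f j *F_) (h j fⱼ≢0)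
    ... | yes z   = trans (cong (_*F x j) z) (trans (*F-zeroˡ _) (sym (trans (cong (_*F y j) z) (*F-zeroˡ _))))

  module _ {g G} (P : Position g G) where
    open Position P

    kernel : ∀ c → Supp act c → (∀ j → free j ≡ true → (c ·ᵣ F) j ≡ 0F) → IsZeroVec c
    kernel c supp z = act-dist c supp (≤-trans (s≤s (≤-reflexive (wt-vanish {free = free} z))) T>0)

    solution : ∃ λ x → (∀ j → free j ≡ false → x j ≡ embed ρ j) × G x
    solution = let x , x≡ρ , sat = solvable (count act) act ≤-refl free F a (embed ρ) kernel in
      x , x≡ρ , implies x x≡ρ sat

    module _ (f : Vecₚ n) where

      -- If a combination with `f` vanishes on `free`, its part from the active rows is supported
      -- there within the support of `f`. This part has weight below `T` and is trivial, and then
      -- `j₀` shows that `f` has coefficient zero.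
      kernel-∷ : ∀ {j₀} → wt free f < T → free j₀ ≡ true → f j₀ ≢ 0F →
        ∀ c → Supp (true ◂ act) c → (∀ j → free j ≡ true → (c ·ᵣ (f ◂ F)) j ≡ 0F) → IsZeroVec c
      kernel-∷ {j₀} small free₀ f≢0 c supp z = λ { fz → head-zero ; (fs i) → tail-zero i }
        where
        tail-zero : IsZeroVec (c ∘ fs)
        tail-zero = act-dist (c ∘ fs) (λ i → supp (fs i)) (≤-<-trans (wt-mono {free = free} {v = f} λ j e fⱼ≡0 →
          trans (sym (trans (·ᵣ-∷ c f F j) (trans (cong (_+F ((c ∘ fs) ·ᵣ F) j)
            (trans (cong (c fz *F_) fⱼ≡0) (*F-zeroʳ _))) (+F-identityˡ _)))) (z j e)) small)
        head-zero : c fz ≡ 0F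
        head-zero = *F-cancelʳ-0 f≢0 (trans (sym (trans (·ᵣ-∷ c f F j₀) (trans (cong (c fz *F f j₀ +F_)
          (ΣF-zero λ i → trans (cong (_*F F i j₀) (tail-zero i)) (*F-zeroˡ _))) (+F-identityʳ _)))) (z j₀ free₀))

      -- `boolean-onto` for the system with the single row `f`, all of whose nonzero multiples have
      -- the same weight.
      onto : D ≤ wt free f → ∀ v → ∃ λ z → evalF f (embed z) ≡ v
      onto long v = let z , _ , solves = boolean-onto M m expanding M ≤-refl (λ (_ : Fin 1) → true) M>0
                          free (λ _ → f) (λ _ → v) ρ dist in z , solves fz refl
        where
        dist : ∀ c → Supp (λ _ → true) c → wt free (c ·ᵣ (λ (_ : Fin 1) → f)) < D → IsZeroVec c
        dist c _ small fz with c fz ≟ 0F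
        ... | yes z = z
        ... | no c≢0 = contradiction (≤-<-trans (≤-trans long (wt-mono {free = free} {v = c ·ᵣ (λ (_ : Fin 1) → f)}
          λ j _ z → *F-cancelˡ-0 c≢0 (trans (sym (ΣF-single fz (λ { fz h → contradiction refl h ; (fs ()) _ }))) z))) small) (n≮n D)

      -- If f is short but does not vanish on free, then f can be prescribed independently of the
      -- position, so no value of f is implied.
      image : ∀ v → (∀ x → G x → evalF f x ≡ v) → ∃ λ z → evalF f (embed z) ≡ v
      image v implied with D ≤? wt free f
      ... | yes long = onto long v
      ... | no short with any? (λ j → free j ∧ nz (f j) Bool.≟ true)
      ...   | no none = let x , x≡ρ , Gx = solution in ρ , trans
        (evalF-agree λ j fⱼ≢0 → sym (x≡ρ j (not-true λ e → none (j , ∧-intro e (nz-intro fⱼ≢0))))) (implied x Gx)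
      ...   | yes (j , e) = contradiction (+F-cancelˡ v (trans (+F-identityʳ v) v≡v+1)) 0F≢1F
        where
        overdetermined : ∃ λ x → (∀ j → free j ≡ false → x j ≡ embed ρ j) ×
          (∀ i → (true ◂ act) i ≡ true → evalF ((f ◂ F) i) x ≡ ((v +F 1F) ◂ a) i)
        overdetermined = solvable (count (true ◂ act)) (true ◂ act) ≤-refl free (f ◂ F) ((v +F 1F) ◂ a) (embed ρ)
          (kernel-∷ (<-≤-trans (≰⇒> short) D≤T) (proj₁ (∧-true {free j} e)) (nz-elim (proj₂ (∧-true {free j} e))))
        v≡v+1 : v ≡ v +F 1F
        v≡v+1 = let x , x≡ρ , sat = overdetermined in
          trans (sym (implied x (implies x x≡ρ (λ i → sat (fs i))))) (sat fz refl)

  infixl 6 _-F_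

  _-F_ : 𝔽 → 𝔽 → 𝔽
  a -F b = a +F -F b

  -F-cancelʳ : ∀ {a b} c → a -F c ≡ b -F c → a ≡ b
  -F-cancelʳ {a} {b} c e = trans (sym (+F-solve a c)) (trans (cong (_+F c) e) (+F-solve b c))

  module _ {g G} (P : Position (suc g) G) (f : Vecₚ n) where
    open Position P

    -- The budget for the branching point still to come leaves room for one more row outside `base`.
    active≤M : suc (count (act ∖∖ base)) ≤ M
    active≤M = *-cancelˡ-≤ T {{>-nonZero T>0}} (begin
      T * suc (count (act ∖∖ base))                                ≤⟨ *-monoʳ-≤ T (m≤m+n (suc (count (act ∖∖ base))) g) ⟩
      T * suc (count (act ∖∖ base) + g)                            ≡⟨ cong (T *_) (+-suc (count (act ∖∖ base)) g) ⟨
      T * (count (act ∖∖ base) + suc g)                            ≤⟨ m+n≤o⇒n≤o (count (fixed free)) budget ⟩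
      T * M                                                        ∎)
      where open ≤-Reasoning

    budget-suc : count (fixed free) + (T + T * (count (act ∖∖ base) + g)) ≤ T * M
    budget-suc = begin
      count (fixed free) + (T + T * (count (act ∖∖ base) + g))     ≡⟨ cong (count (fixed free) +_) (*-suc T _) ⟨
      count (fixed free) + T * suc (count (act ∖∖ base) + g)       ≡⟨ cong (λ k → count (fixed free) + T * k) (+-suc _ g) ⟨
      count (fixed free) + T * (count (act ∖∖ base) + suc g)       ≤⟨ budget ⟩
      T * M                                                        ∎
      where open ≤-Reasoning

    Near : Vecₚ r → Set
    Near c = Supp act c × wt free (f ⊹ c ·ᵣ F) < D

    near? : Dec (∃ Near)
    near? = search
      (λ e (supp , small) → (λ i m → trans (sym (e i)) (supp i m)) ,
        ≤-<-trans (wt-cong {free = free} λ j → cong (f j +F_) (·ᵣ-congˡ F (sym ∘ e) j)) small)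
      (λ c → supp? act c ×-dec (wt free (f ⊹ c ·ᵣ F) <? D))

    module _ {c} (near : Near c) where

      private
        h : Vecₚ n
        h = f ⊹ c ·ᵣ F

        free′ : Fin n → Bool
        free′ j = free j ∧ not (nz (h j))

      -- On solutions of the active rows `f` is `h` minus the combination `c ·ᵣ F`, whose value
      -- there is `evalF c a`.
      value : (Fin n → Bool) → 𝔽
      value ρ′ = evalF h (embed ρ′) -F evalF c a

      implies-value : ∀ ρ′ x → (∀ j → h j ≢ 0F → x j ≡ embed ρ′ j) →
        (∀ i → act i ≡ true → evalF (F i) x ≡ a i) → evalF f x ≡ value ρ′
      implies-value ρ′ x agree sat = +F-cancelˡ (evalF c a) (begin
        evalF c a +F evalF f x                    ≡⟨ +F-comm _ _ ⟩
        evalF f x +F evalF c a                    ≡⟨ cong (evalF f x +F_) (evalF-supp (proj₁ near) sat) ⟨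
        evalF f x +F evalF c (F ·ᶜ x)             ≡⟨ cong (evalF f x +F_) (evalF-·ᵣ c F x) ⟨
        evalF f x +F evalF (c ·ᵣ F) x             ≡⟨ evalF-⊹ˡ f (c ·ᵣ F) x ⟨
        evalF h x                                 ≡⟨ evalF-agree agree ⟩
        evalF h (embed ρ′)                        ≡⟨ +F-solve _ (evalF c a) ⟨
        value ρ′ +F evalF c a                     ≡⟨ +F-comm _ _ ⟩
        evalF c a +F value ρ′                     ∎)
        where open ≡-Reasoning

      implied : (∀ j → free j ≡ true → h j ≡ 0F) → Position (suc g) (With G f (value ρ))
      implied vanish = position F a base act free ρ base⊂act base-dist act-dist budget
        λ x x≡ρ sat → implies x x≡ρ sat , implies-value ρ x
          (λ j hⱼ≢0 → x≡ρ j (not-true λ e → hⱼ≢0 (vanish j e))) sat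

      -- Fixing the free support of `h` costs fewer than `D` coordinates, paid for by the `T` of the
      -- branching point. The active rows keep distance `T` minus `D`, that is `D`, and `restore`
      -- brings it back to `T`. The values of `ρ′` on the support are protected, since only `free′`
      -- is open to later choice.
      commit : ∀ ρ′ → (∀ j → free j ≡ false → ρ′ j ≡ ρ j) → Position g (With G f (value ρ′))
      commit ρ′ ρ′≡ρ = restore (count (act ∖∖ base)) (pending F a base act act free′ free′ ρ′ base⊂act
        (λ _ e → e) (λ _ e → e) base-dist dist
        (λ i e e′ → contradiction e′ (true≢false e))
        (begin
          count (fixed free′) + T * (count (act ∖∖ base) + g)            ≤⟨ +-monoˡ-≤ _ fixed≤ ⟩
          count (fixed free) + T + T * (count (act ∖∖ base) + g)         ≡⟨ +-assoc (count (fixed free)) T _ ⟩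
          count (fixed free) + (T + T * (count (act ∖∖ base) + g))       ≤⟨ budget-suc ⟩
          T * M                                                          ∎)
        (<⇒≤ active≤M)
        (λ x x≡ρ′ sat → implies x
            (λ j e → trans (x≡ρ′ j (cong (_∧ not (nz (h j))) e)) (cong bit (ρ′≡ρ j e))) sat ,
          implies-value ρ′ x (λ j hⱼ≢0 → x≡ρ′ j (trans (cong (λ b → free j ∧ not b) (nz-intro hⱼ≢0)) (Bool.∧-zeroʳ (free j)))) sat))
        ≤-refl
        where
        open ≤-Reasoning
        fixed≤ : count (fixed free′) ≤ count (fixed free) + T
        fixed≤ = ≤-trans (count-cover {Q = fixed free} {R = λ j → free j ∧ nz (h j)} split)
          (+-monoʳ-≤ (count (fixed free)) (≤-trans (<⇒≤ (proj₂ near)) D≤T))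
          where
          split : ∀ j → fixed free′ j ≡ true → fixed free j ≡ true ⊎ free j ∧ nz (h j) ≡ true
          split j e with free j | nz (h j)
          ... | false | _    = inj₁ refl
          ... | true  | true = inj₂ refl
        dist : ∀ c′ → Supp act c′ → wt free′ (c′ ·ᵣ F) < D → IsZeroVec c′
        dist c′ supp small = act-dist c′ supp (≤-<-trans
          (count-cover {Q = λ j → free j ∧ nz (h j)} split) (+-mono-<-≤ (proj₂ near) (<⇒≤ small)))
          where
          split : ∀ j → free j ∧ nz ((c′ ·ᵣ F) j) ≡ true →
            free j ∧ nz (h j) ≡ true ⊎ free′ j ∧ nz ((c′ ·ᵣ F) j) ≡ true
          split j e with free j | nz (h j)
          ... | true | true  = inj₁ refl
          ... | true | false = inj₂ e

      -- Flipping coordinate `j` from false to true adds `h j`.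
      value-changes : ∀ {j} → h j ≢ 0F → value (ρ [ j ≔ false ]) ≢ value (ρ [ j ≔ true ])
      value-changes {j} hⱼ≢0 e = hⱼ≢0 (sym (+F-cancelˡ (evalF h (embed (ρ [ j ≔ false ])))
        (trans (+F-identityʳ _) (trans (-F-cancelʳ (evalF c a) e) flip))))
        where
        pointwise : ∀ l → embed (ρ [ j ≔ true ]) l ≡ (embed (ρ [ j ≔ false ]) ⊹ at j 1F) l
        pointwise l with j ≟ l
        ... | yes _ = trans bit-true (sym (trans (cong (_+F 1F) bit-false) (+F-identityˡ 1F)))
        ... | no _  = sym (+F-identityʳ _)
        flip : evalF h (embed (ρ [ j ≔ true ])) ≡ evalF h (embed (ρ [ j ≔ false ])) +F h j
        flip = trans (evalF-cong (λ _ → refl) pointwise) (trans (evalF-⊹ʳ h (embed (ρ [ j ≔ false ])) (at j 1F))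
          (cong (evalF h (embed (ρ [ j ≔ false ])) +F_) (trans (evalF-comm h (at j 1F)) (trans (evalF-at j 1F h) (*F-identityˡ (h j))))))

    module _ (far : ¬ ∃ Near) where

      -- If `f` occurs with a nonzero coefficient, scaling that coefficient to 1 turns a light
      -- combination into a witness of `Near`. Otherwise the distance of the active rows applies.
      far-dist : ∀ c → Supp (true ◂ act) c → wt free (c ·ᵣ (f ◂ F)) < D → IsZeroVec c
      far-dist c supp small with c fz ≟ 0F
      ... | yes z = λ { fz → z ; (fs i) → act-dist (c ∘ fs) (λ i → supp (fs i)) (<-≤-trans (≤-<-trans
          (wt-cong {free = free} λ j → sym (trans (·ᵣ-∷ c f F j) (trans (cong (_+F ((c ∘ fs) ·ᵣ F) j)
            (trans (cong (_*F f j) z) (*F-zeroˡ _))) (+F-identityˡ _)))) small) D≤T) i }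
      ... | no c₀≢0 with inverse c₀≢0
      ...   | b , b*c₀ = contradiction (b ✶ (c ∘ fs) , (λ i e → trans (cong (b *F_) (supp (fs i) e)) (*F-zeroʳ b)) ,
        ≤-<-trans (wt-mono {free = free} {v = c ·ᵣ (f ◂ F)} λ j _ z → trans (sym (scaled j)) (trans (cong (b *F_) z) (*F-zeroʳ b))) small) far
        where
        open ≡-Reasoning
        scaled : ∀ j → b *F (c ·ᵣ (f ◂ F)) j ≡ (f ⊹ b ✶ (c ∘ fs) ·ᵣ F) j
        scaled j = begin
          b *F (c ·ᵣ (f ◂ F)) j                                ≡⟨ cong (b *F_) (·ᵣ-∷ c f F j) ⟩
          b *F (c fz *F f j +F ((c ∘ fs) ·ᵣ F) j)              ≡⟨ *F-distribˡ b _ _ ⟩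
          b *F (c fz *F f j) +F b *F ((c ∘ fs) ·ᵣ F) j         ≡⟨ cong₂ _+F_ (trans (sym (*F-assoc b (c fz) (f j))) (trans (cong (_*F f j) b*c₀) (*F-identityˡ (f j)))) (sym (evalF-✶ˡ b (c ∘ fs) _)) ⟩
          f j +F (b ✶ (c ∘ fs) ·ᵣ F) j                         ∎

      -- The `T` reserved for the branching point passes to the new row, which is active but outside
      -- `base`, so the budget balances without fixing a coordinate beforehand.
      adjoin : ∀ v → Position g (With G f v)
      adjoin v = restore (count ((true ◂ act) ∖∖ (false ◂ base)))
        (pending (f ◂ F) (v ◂ a) (false ◂ base) (true ◂ act) (true ◂ act) free free ρ
          (λ { (fs i) e → base⊂act i e }) (λ _ e → e) (λ _ e → e)
          (λ c supp small → λ { fz → supp fz refl ; (fs i) → base-dist (c ∘ fs) (λ i → supp (fs i)) (≤-<-trans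
            (wt-cong {free = everywhere} λ j → sym (trans (·ᵣ-∷ c f F j) (trans (cong (_+F ((c ∘ fs) ·ᵣ F) j)
              (trans (cong (_*F f j) (supp fz refl)) (*F-zeroˡ _))) (+F-identityˡ _)))) small) i })
          far-dist
          (λ i e e′ → contradiction e′ (true≢false e))
          (≤-trans (≤-reflexive (cong (count (fixed free) +_) (*-suc T _))) budget-suc)
          active≤M
          (λ x x≡ρ sat → implies x x≡ρ (λ i → sat (fs i)) , sat fz refl))
        ≤-refl

    -- A far form can be given any value, here 0 and 1. For a near form the two values come from the
    -- assignments that differ in one free coordinate of `h`; only if there is none does Delayer
    -- answer without branching, and nothing is spent.
    step : (∃ λ v → Position (suc g) (With G f v)) ⊎
      (∃ λ v₁ → ∃ λ v₂ → v₁ ≢ v₂ × Position g (With G f v₁) × Position g (With G f v₂))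
    step with near?
    ... | no far = inj₂ (0F , 1F , 0F≢1F , adjoin far 0F , adjoin far 1F)
    ... | yes (c , near) with any? (λ j → free j ∧ nz ((f ⊹ c ·ᵣ F) j) Bool.≟ true)
    ...   | no none = inj₁ (value near ρ , implied near λ j e →
      ¬nz (not-true λ e′ → none (j , ∧-intro e e′)))
    ...   | yes (j , e) = let fⱼ , hⱼ≢0 = ∧-true {free j} e in
      inj₂ (_ , _ , value-changes near (nz-elim hⱼ≢0) , commit near (ρ [ j ≔ false ]) (keep fⱼ) , commit near (ρ [ j ≔ true ]) (keep fⱼ))
      where
      keep : ∀ {b} → free j ≡ true → ∀ l → free l ≡ false → (ρ [ j ≔ b ]) l ≡ ρ l
      keep {b} fⱼ l fₗ = ≔-other ρ {j} {l} b λ { refl → true≢false fⱼ fₗ }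

-- Strategies

module Game (p : ℕ) .{{_ : NonZero p}} {k n : ℕ} (A : Field.Matrix p k n) (b : Field.Vecₚ p k) where

  open Field p

  Solution : List (Equation n) → Vecₚ n → Set
  Solution H x = (∀ i → SatisfiesEq x (systemEqs A b i)) × (∀ e → e ∈L H → SatisfiesEq x e)

  extend-solution : ∀ {H f a x} → Solution H x × evalF f x ≡ a → Solution ((f , a) ∷ H) x
  extend-solution ((sat , satH) , e) = sat , λ { _ here → e ; _ (there e∈) → satH _ e∈ }

  data Round (G : ℕ → List (Equation n) → Set) (g : ℕ) (H : List (Equation n)) (f : Form n) : Set where
    forced : ∀ a → a ∈Img f → G (suc g) ((f , a) ∷ H) → Round G g H f
    split  : ∀ a₁ a₂ → ¬ a₁ ≡ a₂ → a₁ ∈Img f → a₂ ∈Img f →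
      G g ((f , a₁) ∷ H) → G g ((f , a₂) ∷ H) → Round G g H f

  -- G g H: from the history H, Delayer can still secure g branching points.
  module Replay (G : ℕ → List (Equation n) → Set)
    (solution : ∀ {g H} → G (suc g) H → ∃ (Solution H))
    (round : ∀ {g H} → G (suc g) H → ∀ f → Round G g H f) where

    -- A strategy sees the history only, so its position is recomputed by replaying it. `nothing`
    -- stands for a history that departs from Delayer's own answers or continues after all promised
    -- branchings.
    Status : List (Equation n) → Set
    Status H = Maybe (∃ λ g → G g H)

    choose : ∀ {H} → Status H → ∀ f → Move f
    choose (just (suc g , P)) f with round P f
    ... | forced a a∈ _                  = single a a∈
    ... | split a₁ a₂ a₁≢a₂ a₁∈ a₂∈ _ _ = branch a₁ a₂ a₁≢a₂ a₁∈ a₂∈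
    -- With nothing left to secure, any attained value will do; this one is attained at the
    -- all-false assignment.
    choose (just (zero , _)) f = single _ ((λ _ → false) , refl)
    choose nothing           f = single _ ((λ _ → false) , refl)

    next : ∀ {H} → Status H → ∀ f a → Status ((f , a) ∷ H)
    next (just (suc g , P)) f a with round P f
    next (just (suc g , P)) f a | forced a′ _ P′ with a ≟ a′
    ... | yes refl = just (suc g , P′)
    ... | no _     = nothing
    next (just (suc g , P)) f a | split a₁ a₂ _ _ _ P₁ P₂ with a ≟ a₁ | a ≟ a₂
    ... | yes refl | _        = just (g , P₁)
    ... | no _     | yes refl = just (g , P₂)
    ... | no _     | no _     = nothing
    next (just (zero , _)) f a = nothing
    next nothing           f a = nothing

    next-forced : ∀ {g H f a a∈ P′} {P : G (suc g) H} → round P f ≡ forced a a∈ P′ →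
      next (just (suc g , P)) f a ≡ just (suc g , P′)
    next-forced {a = a} e rewrite e with a ≟ a
    ... | yes refl = refl
    ... | no a≢a   = contradiction refl a≢a

    next-split₁ : ∀ {g H f a₁ a₂ a₁≢a₂ a₁∈ a₂∈ P₁ P₂} {P : G (suc g) H} →
      round P f ≡ split a₁ a₂ a₁≢a₂ a₁∈ a₂∈ P₁ P₂ → next (just (suc g , P)) f a₁ ≡ just (g , P₁)
    next-split₁ {a₁ = a₁} e rewrite e with a₁ ≟ a₁
    ... | yes refl = refl
    ... | no a≢a   = contradiction refl a≢a

    next-split₂ : ∀ {g H f a₁ a₂ a₁≢a₂ a₁∈ a₂∈ P₁ P₂} {P : G (suc g) H} →
      round P f ≡ split a₁ a₂ a₁≢a₂ a₁∈ a₂∈ P₁ P₂ → next (just (suc g , P)) f a₂ ≡ just (g , P₂)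
    next-split₂ {a₁ = a₁} {a₂} {a₁≢a₂} e rewrite e with a₂ ≟ a₁ | a₂ ≟ a₂
    ... | yes a₂≡a₁ | _        = contradiction (sym a₂≡a₁) a₁≢a₂
    ... | no _      | yes refl = refl
    ... | no _      | no a≢a   = contradiction refl a≢a

    module _ {g₀} (start : G g₀ []) where

      status : ∀ H → Status H
      status []            = just (g₀ , start)
      status ((f , a) ∷ H) = next (status H) f a

      strategy : Strategy n
      strategy H f = choose (status H) f

      -- Along a play `status` tracks the actual position, and each branching lowers the promise by
      -- one. A finished play cannot stop with a positive promise, as such a position has a
      -- solution.
      guarantee : ∀ s {H g} {P : G g H} → status H ≡ just (g , P) →
        Unsolvable A b (proj₁ (run strategy H s)) → g ≤ proj₂ (run strategy H s)
      guarantee s {g = zero} e unsat = z≤n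
      guarantee [] {g = suc g} {P} e unsat = contradiction (solution P) unsat
      guarantee ((f , c) ∷ s) {H} {suc g} {P} e unsat rewrite e with round P f in r
      ... | forced a a∈ P′ = guarantee s (trans (cong (λ z → next z f a) e) (next-forced r)) unsat
      guarantee ((f , true) ∷ s) {H} {suc g} {P} e unsat | split a₁ a₂ _ _ _ P₁ P₂ =
        s≤s (guarantee s (trans (cong (λ z → next z f a₁) e) (next-split₁ r)) unsat)
      guarantee ((f , false) ∷ s) {H} {suc g} {P} e unsat | split a₁ a₂ _ _ _ P₁ P₂ =
        s≤s (guarantee s (trans (cong (λ z → next z f a₂) e) (next-split₂ r)) unsat)

-- Choice of the parameters.

-- Bernoulli's inequality (1 + 1/q)^i ≥ 1 + i/q, cleared of denominators.
bernoulli : ∀ q i → q ^ i * (q + i) ≤ suc q ^ i * q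
bernoulli q zero    = ≤-reflexive (cong (1 *_) (+-identityʳ q))
bernoulli q (suc i) = begin
  q * q ^ i * (q + suc i)                   ≤⟨ m≤m+n _ (q ^ i * i) ⟩
  q * q ^ i * (q + suc i) + q ^ i * i       ≡⟨ regroup q (q ^ i) i ⟩
  suc q * (q ^ i * (q + i))                 ≤⟨ *-monoʳ-≤ (suc q) (bernoulli q i) ⟩
  suc q * (suc q ^ i * q)                   ≡⟨ *-assoc (suc q) (suc q ^ i) q ⟨
  suc q * suc q ^ i * q                     ∎
  where
  open ≤-Reasoning
  regroup : ∀ q z i → q * z * (q + suc i) + z * i ≡ suc q * (z * (q + i))
  regroup = solve-ℕ

n<2^n : ∀ n → n < 2 ^ n
n<2^n zero    = s≤s z≤n
n<2^n (suc n) = begin-strict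
  suc n             ≤⟨ n<2^n n ⟩
  2 ^ n             <⟨ m<m+n (2 ^ n) (m^n>0 2 n) ⟩
  2 ^ n + 2 ^ n     ≡⟨ cong (2 ^ n +_) (+-identityʳ (2 ^ n)) ⟨
  2 ^ suc n         ∎
  where open ≤-Reasoning

^-distribʳ-* : ∀ o m n → (m * n) ^ o ≡ m ^ o * n ^ o
^-distribʳ-* zero    m n = refl
^-distribʳ-* (suc o) m n = trans (cong (m * n *_) (^-distribʳ-* o m n)) (interchange m n (m ^ o) (n ^ o))
  where
  interchange : ∀ m n x y → m * n * (x * y) ≡ m * x * (n * y)
  interchange = solve-ℕ

module Expansion (q : ℕ) (q>0 : 0 < q) where

  C : ℕ
  C = q * suc q

  private instance
    q≢0 : NonZero q
    q≢0 = >-nonZero q>0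

  -- Bernoulli with exponent q, that is (p/q)^q ≥ 2.
  2q^q≤ : 2 * q ^ q ≤ suc q ^ q
  2q^q≤ = *-cancelʳ-≤ (2 * q ^ q) (suc q ^ q) q (begin
    2 * q ^ q * q         ≡⟨ regroup q (q ^ q) ⟩
    q ^ q * (q + q)       ≤⟨ bernoulli q q ⟩
    suc q ^ q * q         ∎)
    where
    open ≤-Reasoning
    regroup : ∀ q z → 2 * z * q ≡ z * (q + q)
    regroup = solve-ℕ

  -- The exponent C = qp is chosen for this: (p/q)^C ≥ 2^p > p.
  expanding-C : q ^ C * suc q < suc q ^ C
  expanding-C = begin-strict
    q ^ C * suc q                       <⟨ *-monoʳ-< (q ^ C) {{m^n≢0 q C}} (n<2^n (suc q)) ⟩
    q ^ C * 2 ^ suc q                   ≡⟨ cong (_* 2 ^ suc q) (^-*-assoc q q (suc q)) ⟨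
    (q ^ q) ^ suc q * 2 ^ suc q         ≡⟨ *-comm _ (2 ^ suc q) ⟩
    2 ^ suc q * (q ^ q) ^ suc q         ≡⟨ ^-distribʳ-* (suc q) 2 (q ^ q) ⟨
    (2 * q ^ q) ^ suc q                 ≤⟨ ^-monoˡ-≤ (suc q) 2q^q≤ ⟩
    (suc q ^ q) ^ suc q                 ≡⟨ ^-*-assoc (suc q) q (suc q) ⟩
    suc q ^ C                           ∎
    where open ≤-Reasoning

  expanding : ∀ {M} → 0 < M → q ^ (C * M) * suc q ^ M < suc q ^ (C * M)
  expanding {M} M>0 = begin-strict
    q ^ (C * M) * suc q ^ M       ≡⟨ cong (_* suc q ^ M) (^-*-assoc q C M) ⟨
    (q ^ C) ^ M * suc q ^ M       ≡⟨ ^-distribʳ-* M (q ^ C) (suc q) ⟨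
    (q ^ C * suc q) ^ M           <⟨ ^-monoˡ-< M {{>-nonZero M>0}} expanding-C ⟩
    (suc q ^ C) ^ M               ≡⟨ ^-*-assoc (suc q) C M ⟩
    suc q ^ (C * M)               ∎
    where open ≤-Reasoning

  C>0 : 0 < C
  C>0 = *-mono-≤ q>0 (s≤s z≤n)

  scale : ∀ {M} → 0 < M → 1 ≤ M * (C * M)
  scale M>0 = *-mono-≤ M>0 (*-mono-≤ C>0 M>0)

  -- With D = C M² the left side is at most 4 C M³, which is then weakened to the fifth power of the
  -- claimed bound.
  fits : ∀ {M} → 0 < M → let D = M * (C * M) in (D + D) * M + (D + D) ≤ 4 * C * M ^ 5
  fits {M} M>0 = begin
    (D + D) * M + (D + D)             ≤⟨ +-monoʳ-≤ ((D + D) * M) (m≤m*n (D + D) M {{>-nonZero M>0}}) ⟩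
    (D + D) * M + (D + D) * M         ≡⟨ regroup C M ⟩
    4 * C * (M * (M * (M * 1)))       ≤⟨ *-monoʳ-≤ (4 * C) (^-monoʳ-≤ M {{>-nonZero M>0}} {3} {5} (s≤s (s≤s (s≤s z≤n)))) ⟩
    4 * C * M ^ 5                     ∎
    where
    open ≤-Reasoning
    D : ℕ
    D = M * (C * M)
    regroup : ∀ C M → (M * (C * M) + M * (C * M)) * M + (M * (C * M) + M * (C * M)) * M ≡ 4 * C * (M * (M * (M * 1)))
    regroup = solve-ℕ

last-true : ∀ {P : ℕ → Set} → Decidable P → P 1 → ∀ k → ¬ P (suc k) → ∃ λ M → 0 < M × P M × ¬ P (suc M)
last-true P? P₁ zero    ¬P = contradiction P₁ ¬P
last-true P? P₁ (suc k) ¬P with P? (suc k)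
... | yes P = suc k , s≤s z≤n , P , ¬P
... | no ¬P′ = last-true P? P₁ k ¬P′

-- `M` is the largest number with N M^5 ≤ d. Then d < N (M + 1)^5 ≤ N (2M)^5, and 32 is 2^5.
fifth-root : ∀ N d → 0 < N → N ≤ d → ∃ λ M → 0 < M × N * M ^ 5 ≤ d × d ≤ N * 32 * M ^ 5
fifth-root N d N>0 N≤d with last-true (λ M → N * M ^ 5 ≤? d) (≤-trans (≤-reflexive (*-identityʳ N)) N≤d) d
    (<⇒≱ (≤-trans (m≤m^n (suc d) 5) (m≤n*m (suc d ^ 5) N {{>-nonZero N>0}})))
  where
  m≤m^n : ∀ m k .{{_ : NonZero k}} → m ≤ m ^ k
  m≤m^n zero    k       = z≤n
  m≤m^n (suc m) (suc k) = m≤m*n (suc m) (suc m ^ k) {{m^n≢0 (suc m) k}}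
... | M , M>0 , below , above = M , M>0 , below , (begin
  d                         ≤⟨ <⇒≤ (≰⇒> above) ⟩
  N * suc M ^ 5             ≤⟨ *-monoʳ-≤ N (^-monoˡ-≤ 5 (≤-trans (+-monoˡ-≤ M M>0) (≤-reflexive (cong (M +_) (sym (+-identityʳ M)))))) ⟩
  N * (2 * M) ^ 5           ≡⟨ cong (N *_) (^-distribʳ-* 5 2 M) ⟩
  N * (32 * M ^ 5)          ≡⟨ *-assoc N 32 (M ^ 5) ⟨
  N * 32 * M ^ 5            ∎)
  where open ≤-Reasoning

-- Delayer's strategies for a given system.

module Delayer (q : ℕ) (prime : Prime (suc q)) {k n : ℕ}
  (A : Field.Matrix (suc q) k n) (b : Field.Vecₚ (suc q) k)
  (full-rank : Field.HasFullRowRank (suc q) A) where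

  open Field (suc q)
  open FieldLaws (suc q) prime using (finiteField)
  open FieldTheory finiteField using (ΣF-zero; ΣF-cong; *F-zeroˡ; *F-zeroʳ; *F-identityˡ)
  open Linear finiteField using (nz; wt; solvable; at; evalF-at; evalF-comm)
  open Replacement finiteField using (zero?)
  open Game (suc q) A b

  ω≡count : ∀ {n} (v : Vecₚ n) → ω v ≡ count (λ j → nz (v j))
  ω≡count {zero}  v = refl
  ω≡count {suc n} v with v fz ≟ 0F
  ... | yes _ = ω≡count (v ∘ fs)
  ... | no _  = cong suc (ω≡count (v ∘ fs))

  system-solvable : ∃ λ x → ∀ i → evalF (A i) x ≡ b i
  system-solvable = let x , _ , sat = solvable (count {k} (λ _ → true)) (λ _ → true) ≤-refl (λ _ → true) A b (λ _ → 0F)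
                                        (λ c _ z → full-rank c (λ j → z j refl)) in
    x , λ i → sat i refl

  evalF-0 : (f : Form n) → evalF f (embed λ _ → false) ≡ 0F
  evalF-0 f = ΣF-zero λ j → *F-zeroʳ (f j)

  module OneBranch where

    -- Positions for distances below the constant, where one branching is enough. Before it is made
    -- Prover has asked zero forms only, so every solution of the system satisfies the history.
    Trivial : ℕ → List (Equation n) → Set
    Trivial 0             H = ⊤
    Trivial 1             H = ∀ x → (∀ i → evalF (A i) x ≡ b i) → ∀ e → e ∈L H → SatisfiesEq x e
    Trivial (suc (suc _)) H = ⊥

    solution : ∀ {g H} → Trivial (suc g) H → ∃ (Solution H)
    solution {zero} P = let x , sat = system-solvable in x , sat , P x sat

    unit-eval : (f : Form n) (j : Fin n) → evalF f (embed λ l → does (j ≟ l)) ≡ f j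
    unit-eval f j = trans (trans (ΣF-cong same) (evalF-comm f (at j 1F))) (trans (evalF-at j 1F f) (*F-identityˡ (f j)))
      where
      same : ∀ l → f l *F bool→𝔽 (does (j ≟ l)) ≡ f l *F at j 1F l
      same l with j ≟ l
      ... | yes _ = refl
      ... | no _  = refl

    -- A form with a nonzero coefficient `f j` takes the values 0 and `f j`, at the all-false
    -- assignment and at the unit vector of `j`.
    round : ∀ {g H} → Trivial (suc g) H → ∀ f → Round Trivial g H f
    round {zero} P f with zero? f
    ... | yes f≡0 = forced 0F ((λ _ → false) , evalF-0 f) λ x sat → λ
      { _ here       → ΣF-zero λ j → trans (cong (_*F x j) (f≡0 j)) (*F-zeroˡ (x j))
      ; e (there e∈) → P x sat e e∈ }
    ... | no f≢0 with any? (λ j → ¬? (f j ≟ 0F))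
    ...   | yes (j , fⱼ≢0) = split 0F (f j) (fⱼ≢0 ∘ sym) ((λ _ → false) , evalF-0 f) ((λ l → does (j ≟ l)) , unit-eval f j) tt tt
    ...   | no none = contradiction (λ j → zero-at j) f≢0
      where
      zero-at : ∀ j → f j ≡ 0F
      zero-at j with f j ≟ 0F
      ... | yes z = z
      ... | no h  = contradiction (j , h) none

    open Replay Trivial solution round

    one-branch : Σ (Strategy n) λ σ → ∀ s → Unsolvable A b (proj₁ (run σ [] s)) → 1 ≤ proj₂ (run σ [] s)
    one-branch = strategy start , λ s → guarantee start s refl
      where
      start : Trivial 1 []
      start x sat e ()

  module ManyBranches (d M m : ℕ) (distance : HasDistance A d)
    (expanding : q ^ m * suc q ^ M < suc q ^ m) (D>0 : 1 ≤ M * m)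
    (d-large : (M * m + M * m) * M + (M * m + M * m) ≤ d) where

    open Positions finiteField n d M m expanding D>0 d-large hiding (solution)

    G : ℕ → List (Equation n) → Set
    G g H = Position g (Solution H)

    weaken : ∀ {g G G′} → (∀ x → G x → G′ x) → Position g G → Position g G′
    weaken h (position F a base act free ρ base⊂act base-dist act-dist budget implies) =
      position F a base act free ρ base⊂act base-dist act-dist budget λ x x≡ρ sat → h x (implies x x≡ρ sat)

    solution : ∀ {g H} → G (suc g) H → ∃ (Solution H)
    solution P = let x , _ , sol = Positions.solution finiteField n d M m expanding D>0 d-large P in x , sol

    -- The position reached after the answer implies `f = v`, and `image` applies to it.
    value-∈Img : ∀ {g H f v} → Position g (With (Solution H) f v) → v ∈Img f
    value-∈Img {f = f} {v} P = image P f v λ x → proj₂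

    round : ∀ {g H} → G (suc g) H → ∀ f → Round G g H f
    round P f with step P f
    ... | inj₁ (v , P′) = forced v (value-∈Img {f = f} P′) (weaken (λ x → extend-solution {x = x}) P′)
    ... | inj₂ (v₁ , v₂ , v₁≢v₂ , P₁ , P₂) = split v₁ v₂ v₁≢v₂ (value-∈Img {f = f} P₁) (value-∈Img {f = f} P₂)
      (weaken (λ _ → extend-solution) P₁) (weaken (λ _ → extend-solution) P₂)

    all : ∀ {r} → Fin r → Bool
    all _ = true

    full-dist : ∀ c → wt all (c ·ᵣ A) < d → IsZeroVec c
    full-dist c small with zero? c
    ... | yes z   = z
    ... | no c≢0 = contradiction (≤-trans (proj₁ distance c c≢0) (≤-reflexive (ω≡count (c ·ᵣ A)))) (<⇒≱ small)

    start : G M []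
    -- All rows belong to `base` and all coordinates are free, so the whole budget `T * M` is
    -- available for the `M` branching points.
    start = position A b all all all (λ _ → false) (λ _ e → e) (λ c _ → full-dist c)
      (λ c _ small → full-dist c (<-≤-trans small (≤-trans (m≤n+m T (T * M)) d-large)))
      (≤-reflexive (cong₂ _+_ (count-none {n}) (cong (λ z → T * (z + M)) (count-none {k}))))
      (λ x _ sat → (λ i → sat i refl) , λ _ ())

    open Replay G solution round

    many-branches : Σ (Strategy n) λ σ → ∀ s → Unsolvable A b (proj₁ (run σ [] s)) → M ≤ proj₂ (run σ [] s)
    many-branches = strategy start , λ s → guarantee start s refl

  module Guarantee (d N : ℕ) (N>0 : 0 < N)
    (many : ∀ M → 0 < M → N * M ^ 5 ≤ d →
      Σ (Strategy n) λ σ → ∀ s → Unsolvable A b (proj₁ (run σ [] s)) → M ≤ proj₂ (run σ [] s)) where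

    -- For d below `N` a single branching already meets the bound; otherwise `M` is the rounded
    -- fifth root of d / N.
    fifth-root-guarantee : Σ (Strategy n) λ σ → GuaranteesRoot5 A b σ (N * 32) d
    fifth-root-guarantee with ≤-<-connex N d
    ... | inj₂ d<N = let σ , h = OneBranch.one-branch in σ , λ s unsat → begin
      d                                     ≤⟨ <⇒≤ d<N ⟩
      N                                     ≤⟨ m≤m*n N 32 ⟩
      N * 32                                ≡⟨ *-identityʳ (N * 32) ⟨
      N * 32 * 1                            ≤⟨ *-monoʳ-≤ (N * 32) (^-monoˡ-≤ 5 (h s unsat)) ⟩
      N * 32 * proj₂ (run σ [] s) ^ 5       ∎
      where open ≤-Reasoning
    ... | inj₁ N≤d = let M , M>0 , below , above = fifth-root N d N>0 N≤d
                         σ , h = many M M>0 below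
                     in σ , λ s unsat → ≤-trans above (*-monoʳ-≤ (N * 32) (^-monoˡ-≤ 5 (h s unsat)))

theorem5p4 : ∀ (p : ℕ) .{{_ : NonZero p}} → Prime p → 5 ≤ p →
    Σ ℕ (λ N → ∀ (k n : ℕ) (A : Field.Matrix p k n) (b : Field.Vecₚ p k) (d : ℕ) →
    Field.HasFullRowRank p A → Field.HasDistance p A d → Field.No01Solution p A b →
    Σ (Field.Strategy p n) (λ σ → Field.GuaranteesRoot5 p A b σ N d))
-- The factor `4 * C` comes from `fits` and 32 from rounding the fifth root; with `m` set to `C * M`
-- the subset sums expand enough for `M` rows.
theorem5p4 (suc q) p-prime 5≤p = 4 * C * 32 , λ k n A b d full-rank distance _ →
  let open Delayer q p-prime A b full-rank in
  Guarantee.fifth-root-guarantee d (4 * C) (*-mono-≤ {1} {4} (s≤s z≤n) C>0) λ M M>0 below →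
    ManyBranches.many-branches d M (C * M) distance (expanding M>0) (scale M>0) (≤-trans (fits M>0) below)
  where open Expansion q (≤-trans (s≤s z≤n) (≤-pred 5≤p))
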